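{- For any constant $\alpha \geq 1$, there is a multigraph $G$ with maximum degree $\Delta$, no cycles of length $3$ or $4$, an assignment of lists each with size $\ell=\alpha\sqrt{\Delta/\ln\Delta}$, an edge labelling $\tau$ with conflict degree $D(\tau) = \ell^{f(\alpha)}$, and such that $G$ does not have a proper conflict colouring from these lists, where $f(\alpha) = 1 - 2^{ -\lfloor \log_{\sqrt{2}}\alpha\rfloor - 1}$ is non-negative for $\alpha \geq 1$, non-decreasing, and tending to $1$ as $\alpha$ approaches infinity. In particular, when $\alpha = 2\sqrt{2} + o(1)$ we have $f(\alpha) = \frac{15}{16}$.
   Context: Multigraphs may have parallel edges (cycles of length 2 are permitted), and parallel edges are counted with multiplicity in degrees. Each vertex $v$ of a multigraph $G=(V,E)$ is assigned a list $L(v)\subset\mathbb{N}$ of candidate colours. An edge labelling is a map $\tau:E\to\mathbb{N}\times\mathbb{N}$ assigning to each edge an ordered pair of colours. For an edge $e=uv$, writing $\tau(e)=(c,c')$ means that $c$ is the colour corresponding to $u$ and $c'$ the colour corresponding to $v$ (written as $e=vu$, the pair is ordered the opposite way); the label forbids $u$ from receiving $c$ and $v$ from receiving $c'$ simultaneously. A proper conflict colouring of $G$ from the lists is a vertex colouring $\sigma$ with $\sigma(v)\in L(v)$ for every $v\in V$ such that there is no edge $e=uv$ with $\tau(e)=(\sigma(u),\sigma(v))$. For a colour $c$ and a pair of vertices $u$ and $v$, let $d(\tau,c,u,v)$ be the number of edges $e=uv$ of $G$ such that $\tau(e)=(c,c')$ for some colour $c'$. The conflict degree $D(\tau)$ is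 the maximum of $d(\tau,c,u,v)$ over all colours $c$ and pairs $u,v$.
   Formalization: The list size is ℓ = ⌈α√(Δ/ln Δ)⌉, since α√(Δ/ln Δ) is never an integer for, e.g., α = 1; and in "α = 2√2 + o(1)" the o(1) term is taken non-negative, since f equals 7/8 just below 2√2. -}

module Defs where

open import Level using (0ℓ)
open import Algebra.Bundles using (CommutativeRing; Semiring)
open import Axiom.ExcludedMiddle using (ExcludedMiddle)
open import Data.Fin.Base using (Fin; toℕ)
import Data.Fin.Properties as Fin
open import Data.Integer.Base using (ℤ; +_; -[1+_])
import Data.Integer.Base as ℤ
open import Data.List.Base using (List; length; filter; allFin)
open import Data.List.Membership.Propositional using (_∈_)
open import Data.List.Relation.Unary.Unique.Propositional using (Unique)
open import Data.Nat.Base as ℕ using (ℕ; zero; suc; NonZero; _!)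
import Data.Nat.Properties as ℕ
open import Data.Nat.DivMod using (_mod_)
open import Data.Product.Base using (Σ; ∃; _×_; _,_; proj₁; proj₂)
open import Data.Sum.Base using (_⊎_; inj₁; inj₂; [_,_]′)
open import Function.Definitions using (Injective)
open import Relation.Binary.Core using (Rel)
open import Relation.Binary.Structures using (IsTotalOrder)
open import Relation.Binary.PropositionalEquality.Core using (_≡_; _≢_; refl)
open import Relation.Nullary using (¬_; Dec; yes; no; map′; _×-dec_; _⊎-dec_)
import Algebra.Definitions.RawSemiring as RawSemiring
import Relation.Binary.Construct.NonStrictToStrict as Strict

------------------------------------------------------------------------
-- Multigraphs

-- Each edge is stored with an arbitrary orientation, source to target. It only
-- fixes which component of a label belongs to which end; all notions below are
-- symmetric in the two ends.
record Multigraph : Set where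
  field
    ∣V∣ ∣E∣  : ℕ
    source   : Fin ∣E∣ → Fin ∣V∣
    target   : Fin ∣E∣ → Fin ∣V∣
    loopless : ∀ e → source e ≢ target e

  V E : Set
  V = Fin ∣V∣
  E = Fin ∣E∣

_IsMaximumOf_ : {I : Set} → ℕ → (I → ℕ) → Set
m IsMaximumOf f = (∀ i → f i ℕ.≤ m) × (∃ λ i → f i ≡ m)

module _ (G : Multigraph) where
  open Multigraph G

  Joins : E → V → V → Set
  Joins e u v = (source e ≡ u × target e ≡ v) ⊎ (source e ≡ v × target e ≡ u)

  degree : V → ℕ
  degree v = length (filter (λ e → (source e Fin.≟ v) ⊎-dec (target e Fin.≟ v)) (allFin ∣E∣))

  IsMaxDegree : ℕ → Set
  IsMaxDegree Δ = Δ IsMaximumOf degree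

  -- For k = 2 this is a pair of distinct parallel edges.
  record Cycle (k : ℕ) .{{_ : NonZero k}} : Set where
    field
      vertex           : Fin k → V
      edge             : Fin k → E
      vertex-injective : Injective _≡_ _≡_ vertex
      edge-injective   : Injective _≡_ _≡_ edge
      joins            : ∀ i → Joins (edge i) (vertex i) (vertex (suc (toℕ i) mod k))

  ----------------------------------------------------------------------
  -- Conflict colouring

  Lists : Set
  Lists = V → List ℕ

  AllOfSize : ℕ → Lists → Set
  AllOfSize ℓ L = ∀ v → Unique (L v) × length (L v) ≡ ℓ

  -- The first component belongs to the source, the second to the target.
  EdgeLabelling : Set
  EdgeLabelling = E → ℕ × ℕ

  -- Written as e = uv, the edge e has label (c , c′).
  Labelled : EdgeLabelling → (e : E) (u v : V) (c c′ : ℕ) → Set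
  Labelled τ e u v c c′ = (source e ≡ u × target e ≡ v × τ e ≡ (c , c′))
                        ⊎ (source e ≡ v × target e ≡ u × τ e ≡ (c′ , c))

  labelled? : ∀ τ c u v e → Dec (∃ λ c′ → Labelled τ e u v c c′)
  labelled? τ c u v e = map′ to from
    (((source e Fin.≟ u) ×-dec (target e Fin.≟ v) ×-dec (proj₁ (τ e) ℕ.≟ c)) ⊎-dec
     ((source e Fin.≟ v) ×-dec (target e Fin.≟ u) ×-dec (proj₂ (τ e) ℕ.≟ c)))
    where
    to : _ → ∃ λ c′ → Labelled τ e u v c c′
    to (inj₁ (s , t , refl)) = proj₂ (τ e) , inj₁ (s , t , refl)
    to (inj₂ (s , t , refl)) = proj₁ (τ e) , inj₂ (s , t , refl)
    from : (∃ λ c′ → Labelled τ e u v c c′) →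
           (source e ≡ u × target e ≡ v × proj₁ (τ e) ≡ c) ⊎
           (source e ≡ v × target e ≡ u × proj₂ (τ e) ≡ c)
    from (_ , inj₁ (s , t , eq)) rewrite eq = inj₁ (s , t , refl)
    from (_ , inj₂ (s , t , eq)) rewrite eq = inj₂ (s , t , refl)

  d : EdgeLabelling → ℕ → V → V → ℕ
  d τ c u v = length (filter (labelled? τ c u v) (allFin ∣E∣))

  IsConflictDegree : EdgeLabelling → ℕ → Set
  IsConflictDegree τ D = D IsMaximumOf λ ((c , u , v) : ℕ × V × V) → d τ c u v

  ProperConflictColouring : Lists → EdgeLabelling → Set
  ProperConflictColouring L τ = Σ (V → ℕ) λ σ →
    (∀ v → σ v ∈ L v) × (∀ e u v → ¬ Labelled τ e u v (σ u) (σ v))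

------------------------------------------------------------------------
-- The real numbers, as a complete ordered field

record CompleteOrderedField : Set₁ where
  field
    commutativeRing : CommutativeRing 0ℓ 0ℓ

  open CommutativeRing commutativeRing public
    using (Carrier; _≈_; _+_; _*_; -_; _-_; 0#; 1#; semiring)

  infix  8 _⁻¹
  infix  4 _≤_

  field
    _≤_          : Rel Carrier 0ℓ
    _⁻¹          : Carrier → Carrier
    isTotalOrder : IsTotalOrder _≈_ _≤_
    0≉1          : ¬ 0# ≈ 1#
    ⁻¹-cong      : ∀ {x y} → x ≈ y → x ⁻¹ ≈ y ⁻¹
    ⁻¹-inverseʳ  : ∀ x → ¬ x ≈ 0# → x * x ⁻¹ ≈ 1#
    +-monoˡ-≤    : ∀ {x y} z → x ≤ y → x + z ≤ y + z
    *-nonNeg     : ∀ {x y} → 0# ≤ x → 0# ≤ y → 0# ≤ x * y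

  UpperBound : (Carrier → Set) → Carrier → Set
  UpperBound P b = ∀ x → P x → x ≤ b

  LeastUpperBound : (Carrier → Set) → Carrier → Set
  LeastUpperBound P s = UpperBound P s × (∀ b → UpperBound P b → s ≤ b)

  field
    complete : (P : Carrier → Set) → ∃ P → ∃ (UpperBound P) → ∃ (LeastUpperBound P)

module Analysis (em : ExcludedMiddle 0ℓ) (R : CompleteOrderedField) where

  open CompleteOrderedField R public
  open Strict _≈_ _≤_ public using (_<_)
  open RawSemiring (Semiring.rawSemiring semiring) using (_^_) renaming (_×_ to _·_)

  ℝ : Set
  ℝ = Carrier

  infixl 7 _/_
  infix  4 _⟶_

  -- An element satisfying P, or the default if there is none. Below, P always
  -- has at most one solution up to equality.
  the : {A : Set} → A → (A → Set) → A
  the default P with em {P = ∃ P}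
  ... | yes (x , _) = x
  ... | no  _       = default

  _/_ : ℝ → ℝ → ℝ
  x / y = x * y ⁻¹

  fromℕ : ℕ → ℝ
  fromℕ n = n · 1#

  fromℤ : ℤ → ℝ
  fromℤ (+ n)    = fromℕ n
  fromℤ -[1+ n ] = - fromℕ (suc n)

  ∣_∣ : ℝ → ℝ
  ∣ x ∣ = [ (λ _ → x) , (λ _ → - x) ]′ (IsTotalOrder.total isTotalOrder 0# x)

  ⌊_⌋ : ℝ → ℤ
  ⌊ x ⌋ = the (+ 0) λ z → fromℤ z ≤ x × x < fromℤ z + 1#

  ⌈_⌉ : ℝ → ℤ
  ⌈ x ⌉ = ℤ.- ⌊ - x ⌋

  _⟶_ : (ℕ → ℝ) → ℝ → Set
  a ⟶ x = ∀ ε → 0# < ε → ∃ λ N → ∀ n → N ℕ.≤ n → ∣ a n - x ∣ ≤ ε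

  lim : (ℕ → ℝ) → ℝ
  lim a = the 0# (a ⟶_)

  expSum : ℝ → ℕ → ℝ
  expSum x zero    = 0#
  expSum x (suc n) = expSum x n + (x ^ n) / fromℕ (n !)

  exp : ℝ → ℝ
  exp x = lim (expSum x)

  ln : ℝ → ℝ
  ln x = the 0# λ y → exp y ≈ x

  log : (base : ℝ) → ℝ → ℝ
  log b x = ln x / ln b

  infixr 8 _^ʳ_

  -- Meant for positive bases.
  _^ʳ_ : ℝ → ℝ → ℝ
  x ^ʳ y = exp (y * ln x)

  √_ : ℝ → ℝ
  √ x = the 0# λ y → 0# ≤ y × y * y ≈ x

  f : ℝ → ℝ
  f α = 1# - fromℕ 2 ^ʳ (- fromℤ ⌊ log (√ fromℕ 2) α ⌋ - 1#)

{-# OPTIONS --safe #-}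

-- Let α² < K = 2 ^ n with n least, so that f α = 1 - 1/K, and put ℓ = m ^ K and D = ℓ / m for a large m.
--
-- Take a bipartite graph without 4-cycles whose degrees are at most δ, slightly more than 2 m² ln m, with nearly δ/2 edges
-- per vertex. Some pair of colours at the ends of an edge rules out a proportion 1/m² of any set of m-colourings; choosing
-- such labels edge by edge leaves no colouring at all, because m² (1 - 1/m²) ^ δ < 1. Replacing each colour by a group
-- of D colours, and each edge by D² parallel ones that forbid a pair of groups, gives lists of size ℓ, conflict degree D
-- and maximum degree at most δ D², about (2/K) ℓ² ln ℓ. As α² < K, this is less than the degree Δ, about (2/α²) ℓ² ln ℓ, at
-- which α √(Δ / ln Δ) reaches ℓ.
--
-- The incidences of the points (x , y) with the lines y = b - a x, x and a ranging over δ values, form such a graph.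

module Submission where

open import Defs
open import Level using (0ℓ)
open import Axiom.ExcludedMiddle using (ExcludedMiddle)
open import Data.Integer.Base using (+_)
open import Data.Nat.Base as ℕ using (ℕ)
open import Data.Product.Base using (Σ; ∃; _×_)
open import Relation.Binary.PropositionalEquality.Core using (_≡_)
open import Relation.Nullary using (¬_)

open import Algebra.Bundles using (CommutativeRing)
import Algebra.Properties.AbelianGroup
import Algebra.Properties.CommutativeSemiring.Exp
import Algebra.Properties.Ring
import Algebra.Properties.Semiring.Exp
import Algebra.Properties.Semiring.Mult
import Algebra.Properties.Semiring.Mult.TCOptimised
import Algebra.Solver.Ring
open import Algebra.Solver.Ring.AlmostCommutativeRing using (_-Raw-AlmostCommutative⟶_; fromCommutativeRing)
import Data.Fin.Base
open import Data.Empty using (⊥-elim)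
open import Data.Integer.Base as ℤ using (ℤ; -[1+_])
import Data.Integer.Properties as ℤ
open import Data.Maybe.Base using (Maybe; just; nothing)
open import Data.Nat.Base using (zero; suc; _∸_; _!)
import Data.Nat.Properties as ℕ
open import Data.Product.Base using (_,_; proj₁; proj₂)
open import Data.Sum.Base using (_⊎_; inj₁; inj₂)
open import Function.Base using (_∘_)
open import Relation.Binary.Bundles using (Poset)
import Relation.Binary.Construct.NonStrictToStrict as Strict
open import Relation.Binary.PropositionalEquality.Core as ≡ using ()
import Relation.Binary.Reasoning.PartialOrder
import Relation.Binary.Reasoning.Setoid
open import Relation.Binary.Structures using (IsTotalOrder)
open import Relation.Nullary using (yes; no; ¬?)
open import Relation.Nullary.Decidable using (decidable-stable)

-- Two equalities in the claim are exact: D is ℓ to the power `f α`, and ℓ is a ceiling. The first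
-- is met by making ℓ a perfect K-th power, which fixes ℓ as soon as m is chosen. The second must
-- then be met by tuning Δ alone, and this is possible because edges disjoint from the rest can
-- raise the maximum degree at will. Two strict inequalities absorb all errors. That α² < K leaves
-- room for rounding δ to an integer. That m² (1 - 1/m²) ^ δ < 1 leaves room for having slightly
-- fewer than δ/2 edges per vertex: with n vertices and E edges the greedy choice needs m ^ n (1 -
-- 1/m²) ^ E < 1. A bundle has D² edges, yet the conflict degree is only D, since a fixed colour at
-- one end occurs on just D of them. The reals are an abstract complete ordered field, and `exp`,
-- `ln`, `√` and `⌊_⌋` are descriptions that mean nothing until existence is proved. Suprema provide
-- it; `ln` and `√` are only ever taken of numbers that are at least 1.

-- A ring solver for the reals with integer coefficients

module OrderedFieldSolver (em : ExcludedMiddle 0ℓ) (R : CompleteOrderedField) where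

  open Analysis em R public
  open CommutativeRing commutativeRing public
    using (refl; sym; trans; reflexive; setoid; ring; +-cong; +-congˡ; +-congʳ; *-cong; *-congˡ; *-congʳ; -‿cong;
           +-identityˡ; +-identityʳ; *-identityˡ; *-identityʳ; *-comm; +-comm; *-assoc; +-assoc; distribˡ; distribʳ;
           zeroˡ; zeroʳ; -‿inverseʳ)
  open Algebra.Properties.Semiring.Mult semiring public
    using (×-homo-+; ×1-homo-*)
  open Algebra.Properties.Semiring.Mult.TCOptimised semiring
    using () renaming (_×_ to _·′_; ×-homo-+ to ·′-homo-+; ×1-homo-* to ·′1-homo-*; 1+× to 1+·′)
  open Algebra.Properties.Semiring.Exp semiring public
    using (_^_; ^-congˡ)
  open Algebra.Properties.Ring ring public using (-‿distribˡ-*; -‿distribʳ-*; -‿involutive; -0#≈0#)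
  open Algebra.Properties.AbelianGroup (CommutativeRing.+-abelianGroup commutativeRing) using (⁻¹-∙-comm)

  ≤-poset : Poset 0ℓ 0ℓ 0ℓ
  ≤-poset = record { isPartialOrder = IsTotalOrder.isPartialOrder isTotalOrder }

  module ≤-Reasoning = Relation.Binary.Reasoning.PartialOrder ≤-poset

  private
    -- With the optimised multiple the coefficient 1 denotes `1#` itself and not `1# + 0#`, so that
    -- solved equations can be stated with a bare `1#`.
    ⟦_⟧ℤ : ℤ → ℝ
    ⟦ + n ⟧ℤ      = n ·′ 1#
    ⟦ -[1+ n ] ⟧ℤ = - (suc n ·′ 1#)

    open Relation.Binary.Reasoning.Setoid setoid

    cancel1 : ∀ a b → (1# + a) + - (1# + b) ≈ a + - b
    cancel1 a b = begin
      (1# + a) + - (1# + b)     ≈⟨ +-cong (+-comm 1# a) (sym (⁻¹-∙-comm 1# b)) ⟩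
      (a + 1#) + (- 1# + - b)   ≈⟨ +-assoc a 1# _ ⟩
      a + (1# + (- 1# + - b))   ≈⟨ +-congˡ (+-assoc 1# (- 1#) (- b)) ⟨
      a + ((1# + - 1#) + - b)   ≈⟨ +-congˡ (+-congʳ (-‿inverseʳ 1#)) ⟩
      a + (0# + - b)            ≈⟨ +-congˡ (+-identityˡ (- b)) ⟩
      a + - b                   ∎

    ⊖-homo : ∀ m n → ⟦ m ℤ.⊖ n ⟧ℤ ≈ m ·′ 1# + - (n ·′ 1#)
    ⊖-homo m       zero    = sym (trans (+-congˡ -0#≈0#) (+-identityʳ _))
    ⊖-homo zero    (suc n) = sym (+-identityˡ _)
    ⊖-homo (suc m) (suc n) = begin
      ⟦ suc m ℤ.⊖ suc n ⟧ℤ             ≡⟨ ≡.cong ⟦_⟧ℤ (ℤ.[1+m]⊖[1+n]≡m⊖n m n) ⟩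
      ⟦ m ℤ.⊖ n ⟧ℤ                     ≈⟨ ⊖-homo m n ⟩
      m ·′ 1# + - (n ·′ 1#)            ≈⟨ cancel1 _ _ ⟨
      (1# + m ·′ 1#) + - (1# + n ·′ 1#) ≈⟨ +-cong (1+·′ m 1#) (-‿cong (1+·′ n 1#)) ⟨
      suc m ·′ 1# + - (suc n ·′ 1#)    ∎

    +-homo : ∀ i j → ⟦ i ℤ.+ j ⟧ℤ ≈ ⟦ i ⟧ℤ + ⟦ j ⟧ℤ
    +-homo (+ m)      (+ n)      = ·′-homo-+ 1# m n
    +-homo (+ m)      -[1+ n ]   = ⊖-homo m (suc n)
    +-homo -[1+ m ]   (+ n)      = trans (⊖-homo n (suc m)) (+-comm _ _)
    +-homo -[1+ m ]   -[1+ n ]   = begin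
      - (suc (suc (m ℕ.+ n)) ·′ 1#)        ≡⟨ ≡.cong (λ k → - (k ·′ 1#)) (ℕ.+-suc (suc m) n) ⟨
      - ((suc m ℕ.+ suc n) ·′ 1#)          ≈⟨ -‿cong (·′-homo-+ 1# (suc m) (suc n)) ⟩
      - (suc m ·′ 1# + suc n ·′ 1#)        ≈⟨ ⁻¹-∙-comm _ _ ⟨
      - (suc m ·′ 1#) + - (suc n ·′ 1#)    ∎

    -‿homo : ∀ i → ⟦ ℤ.- i ⟧ℤ ≈ - ⟦ i ⟧ℤ
    -‿homo (+ zero)   = sym -0#≈0#
    -‿homo (+ suc n)  = refl
    -‿homo -[1+ n ]   = sym (-‿involutive _)

    *-homo : ∀ i j → ⟦ i ℤ.* j ⟧ℤ ≈ ⟦ i ⟧ℤ * ⟦ j ⟧ℤ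
    *-homo (+ m) (+ n) = trans (reflexive (≡.cong ⟦_⟧ℤ (≡.sym (ℤ.pos-* m n)))) (·′1-homo-* m n)
    *-homo (+ m) -[1+ n ] = begin
      ⟦ + m ℤ.* -[1+ n ] ⟧ℤ        ≡⟨ ≡.cong ⟦_⟧ℤ (ℤ.neg-distribʳ-* (+ m) (+ suc n)) ⟨
      ⟦ ℤ.- (+ m ℤ.* + suc n) ⟧ℤ   ≈⟨ -‿homo (+ m ℤ.* + suc n) ⟩
      - ⟦ + m ℤ.* + suc n ⟧ℤ       ≈⟨ -‿cong (*-homo (+ m) (+ suc n)) ⟩
      - (⟦ + m ⟧ℤ * ⟦ + suc n ⟧ℤ)  ≈⟨ -‿distribʳ-* _ _ ⟩
      ⟦ + m ⟧ℤ * - ⟦ + suc n ⟧ℤ    ∎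
    *-homo -[1+ m ] (+ n) = begin
      ⟦ -[1+ m ] ℤ.* + n ⟧ℤ        ≡⟨ ≡.cong ⟦_⟧ℤ (ℤ.neg-distribˡ-* (+ suc m) (+ n)) ⟨
      ⟦ ℤ.- (+ suc m ℤ.* + n) ⟧ℤ   ≈⟨ -‿homo (+ suc m ℤ.* + n) ⟩
      - ⟦ + suc m ℤ.* + n ⟧ℤ       ≈⟨ -‿cong (*-homo (+ suc m) (+ n)) ⟩
      - (⟦ + suc m ⟧ℤ * ⟦ + n ⟧ℤ)  ≈⟨ -‿distribˡ-* _ _ ⟩
      - ⟦ + suc m ⟧ℤ * ⟦ + n ⟧ℤ    ∎
    *-homo -[1+ m ] -[1+ n ] = begin
      (suc m ℕ.* suc n) ·′ 1#            ≈⟨ ·′1-homo-* (suc m) (suc n) ⟩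
      (suc m ·′ 1#) * (suc n ·′ 1#)      ≈⟨ -‿involutive _ ⟨
      - - ((suc m ·′ 1#) * (suc n ·′ 1#)) ≈⟨ -‿cong (-‿distribˡ-* _ _) ⟩
      - (- (suc m ·′ 1#) * (suc n ·′ 1#)) ≈⟨ -‿distribʳ-* _ _ ⟩
      - (suc m ·′ 1#) * - (suc n ·′ 1#)  ∎

    ℤ-coefficients : ℤ.+-*-rawRing -Raw-AlmostCommutative⟶ fromCommutativeRing commutativeRing
    ℤ-coefficients = record
      { ⟦_⟧ = ⟦_⟧ℤ ; +-homo = +-homo ; *-homo = *-homo ; -‿homo = -‿homo ; 0-homo = refl ; 1-homo = refl }

    _coeff≟_ : ∀ i j → Maybe (⟦ i ⟧ℤ ≈ ⟦ j ⟧ℤ)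
    i coeff≟ j with i ℤ.≟ j
    ... | yes i≡j = just (reflexive (≡.cong ⟦_⟧ℤ i≡j))
    ... | no  _   = nothing

  open Algebra.Solver.Ring ℤ.+-*-rawRing (fromCommutativeRing commutativeRing) ℤ-coefficients _coeff≟_ public
    using (Polynomial; con; solve; _:+_; _:*_; _:-_; :-_; _:=_)

  -- c2 evaluates to fromℕ 2 definitionally, which con (+ 2) does not.
  c0 c1 c2 : ∀ {n} → Polynomial n
  c0 = con (+ 0)
  c1 = con (+ 1)
  c2 = c1 :+ (c1 :+ c0)

-- Inequalities, division and the Archimedean property

module OrderedField (em : ExcludedMiddle 0ℓ) (R : CompleteOrderedField) where

  open OrderedFieldSolver em R

  open IsTotalOrder isTotalOrder public using ()
    renaming (refl to ≤-refl; trans to ≤-trans; reflexive to ≤-reflexive; antisym to ≤-antisym; total to ≤-total;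
              ≤-respˡ-≈ to ≤-respˡ-≈; ≤-respʳ-≈ to ≤-respʳ-≈)

  open ≤-Reasoning

  ≰⇒> : ∀ {x y} → ¬ x ≤ y → y < x
  ≰⇒> = Strict.≰⇒> _≈_ _≤_ sym ≤-reflexive ≤-total

  <⇒≤ : ∀ {x y} → x < y → x ≤ y
  <⇒≤ = proj₁

  <⇒≱ : ∀ {x y} → x < y → ¬ y ≤ x
  <⇒≱ = Strict.<⇒≱ _≈_ _≤_ ≤-antisym

  ≮⇒≥ : ∀ {x y} → ¬ x < y → y ≤ x
  ≮⇒≥ {x} {y} x≮y = decidable-stable em λ y≰x → x≮y (≰⇒> y≰x)

  <-≤-trans : ∀ {x y z} → x < y → y ≤ z → x < z
  <-≤-trans = Strict.<-≤-trans _≈_ _≤_ sym ≤-trans ≤-antisym ≤-respʳ-≈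

  ≤-<-trans : ∀ {x y z} → x ≤ y → y < z → x < z
  ≤-<-trans = Strict.≤-<-trans _≈_ _≤_ ≤-trans ≤-antisym ≤-respˡ-≈

  <-trans : ∀ {x y z} → x < y → y < z → x < z
  <-trans x<y y<z = <-≤-trans x<y (<⇒≤ y<z)

  <-respʳ-≈ : ∀ {x y z} → y ≈ z → x < y → x < z
  <-respʳ-≈ y≈z x<y = <-≤-trans x<y (≤-reflexive y≈z)

  <-respˡ-≈ : ∀ {x y z} → x ≈ z → x < y → z < y
  <-respˡ-≈ x≈z x<y = ≤-<-trans (≤-reflexive (sym x≈z)) x<y

  x≤y⇒0≤y-x : ∀ {x y} → x ≤ y → 0# ≤ y - x
  x≤y⇒0≤y-x {x} x≤y = ≤-respˡ-≈ (-‿inverseʳ x) (+-monoˡ-≤ (- x) x≤y)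

  -- Linear inequalities are proved by exhibiting the difference as a visibly nonnegative t.
  ≤-diff : ∀ {x y t} → 0# ≤ t → t ≈ y - x → x ≤ y
  ≤-diff {x} {y} {t} 0≤t eq = begin
    x            ≈⟨ +-identityˡ x ⟨
    0# + x       ≤⟨ +-monoˡ-≤ x 0≤t ⟩
    t + x        ≈⟨ +-congʳ eq ⟩
    (y - x) + x  ≈⟨ solve 2 (λ x y → (y :- x) :+ x := y) refl x y ⟩
    y            ∎

  x<y⇒0<y-x : ∀ {x y} → x < y → 0# < y - x
  x<y⇒0<y-x {x} {y} (x≤y , x≉y) = x≤y⇒0≤y-x x≤y , λ 0≈y-x → x≉y (begin-equality
    x            ≈⟨ +-identityˡ x ⟨
    0# + x       ≈⟨ +-congʳ 0≈y-x ⟩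
    (y - x) + x  ≈⟨ solve 2 (λ x y → (y :- x) :+ x := y) refl x y ⟩
    y            ∎)

  <-diff : ∀ {x y t} → 0# < t → t ≈ y - x → x < y
  <-diff {x} {y} {t} (0≤t , 0≉t) eq = ≤-diff 0≤t eq , λ x≈y → 0≉t (sym (trans eq
    (trans (+-congˡ (-‿cong x≈y)) (-‿inverseʳ y))))

  +-mono-≤ : ∀ {x y u v} → x ≤ y → u ≤ v → x + u ≤ y + v
  +-mono-≤ {x} {y} {u} {v} x≤y u≤v = begin
    x + u  ≤⟨ +-monoˡ-≤ u x≤y ⟩
    y + u  ≈⟨ +-comm y u ⟩
    u + y  ≤⟨ +-monoˡ-≤ y u≤v ⟩
    v + y  ≈⟨ +-comm v y ⟩
    y + v  ∎

  +-nonNeg : ∀ {x y} → 0# ≤ x → 0# ≤ y → 0# ≤ x + y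
  +-nonNeg 0≤x 0≤y = ≤-respˡ-≈ (+-identityˡ 0#) (+-mono-≤ 0≤x 0≤y)

  +-pos : ∀ {x y} → 0# < x → 0# ≤ y → 0# < x + y
  +-pos {x} {y} 0<x 0≤y = <-≤-trans 0<x (≤-diff 0≤y (solve 2 (λ x y → y := (x :+ y) :- x) refl x y))

  neg-mono-≤ : ∀ {x y} → x ≤ y → - y ≤ - x
  neg-mono-≤ {x} {y} x≤y = ≤-diff (x≤y⇒0≤y-x x≤y) (solve 2 (λ x y → y :- x := (:- x) :- (:- y)) refl x y)

  *-monoˡ-≤ : ∀ {x y} z → 0# ≤ z → x ≤ y → z * x ≤ z * y
  *-monoˡ-≤ {x} {y} z 0≤z x≤y = ≤-diff (*-nonNeg 0≤z (x≤y⇒0≤y-x x≤y))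
    (solve 3 (λ x y z → z :* (y :- x) := z :* y :- z :* x) refl x y z)

  *-monoʳ-≤ : ∀ {x y} z → 0# ≤ z → x ≤ y → x * z ≤ y * z
  *-monoʳ-≤ {x} {y} z 0≤z x≤y = ≤-diff (*-nonNeg (x≤y⇒0≤y-x x≤y) 0≤z)
    (solve 3 (λ x y z → (y :- x) :* z := y :* z :- x :* z) refl x y z)

  *-mono-≤ : ∀ {x y u v} → 0# ≤ x → 0# ≤ u → x ≤ y → u ≤ v → x * u ≤ y * v
  *-mono-≤ {x} {y} {u} {v} 0≤x 0≤u x≤y u≤v =
    ≤-trans (*-monoʳ-≤ u 0≤u x≤y) (*-monoˡ-≤ y (≤-trans 0≤x x≤y) u≤v)

  square-nonNeg : ∀ x → 0# ≤ x * x
  square-nonNeg x with ≤-total 0# x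
  ... | inj₁ 0≤x = *-nonNeg 0≤x 0≤x
  ... | inj₂ x≤0 = ≤-respʳ-≈ (solve 1 (λ x → (c0 :- x) :* (c0 :- x) := x :* x) refl x)
                     (*-nonNeg (x≤y⇒0≤y-x x≤0) (x≤y⇒0≤y-x x≤0))

  0≤1 : 0# ≤ 1#
  0≤1 = ≤-respʳ-≈ (*-identityˡ 1#) (square-nonNeg 1#)

  0<1 : 0# < 1#
  0<1 = 0≤1 , 0≉1

  <⇒≉ : ∀ {x y} → x < y → ¬ y ≈ x
  <⇒≉ (_ , x≉y) y≈x = x≉y (sym y≈x)

  *-inverseʳ : ∀ {x} → 0# < x → x * x ⁻¹ ≈ 1#
  *-inverseʳ {x} 0<x = ⁻¹-inverseʳ x (<⇒≉ 0<x)

  *-pos : ∀ {x y} → 0# < x → 0# < y → 0# < x * y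
  *-pos {x} {y} 0<x 0<y = *-nonNeg (<⇒≤ 0<x) (<⇒≤ 0<y) , λ 0≈xy → <⇒≉ 0<y (begin-equality
    y                  ≈⟨ *-identityˡ y ⟨
    1# * y             ≈⟨ *-congʳ (*-inverseʳ 0<x) ⟨
    (x * x ⁻¹) * y     ≈⟨ solve 3 (λ x i y → (x :* i) :* y := i :* (x :* y)) refl x (x ⁻¹) y ⟩
    x ⁻¹ * (x * y)     ≈⟨ *-congˡ 0≈xy ⟨
    x ⁻¹ * 0#          ≈⟨ zeroʳ _ ⟩
    0#                 ∎)

  *-monoʳ-< : ∀ {x y} z → 0# < z → x < y → x * z < y * z
  *-monoʳ-< {x} {y} z 0<z x<y = <-diff (*-pos (x<y⇒0<y-x x<y) 0<z)
    (solve 3 (λ x y z → (y :- x) :* z := y :* z :- x :* z) refl x y z)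

  *-monoˡ-< : ∀ {x y} z → 0# < z → x < y → z * x < z * y
  *-monoˡ-< {x} {y} z 0<z x<y = <-diff (*-pos 0<z (x<y⇒0<y-x x<y))
    (solve 3 (λ x y z → z :* (y :- x) := z :* y :- z :* x) refl x y z)

  *-cancelʳ-≤ : ∀ {x y} z → 0# < z → x * z ≤ y * z → x ≤ y
  *-cancelʳ-≤ z 0<z xz≤yz = ≮⇒≥ λ y<x → <⇒≱ (*-monoʳ-< z 0<z y<x) xz≤yz

  *-cancelʳ-< : ∀ {x y} z → 0# ≤ z → x * z < y * z → x < y
  *-cancelʳ-< z 0≤z xz<yz = ≰⇒> λ y≤x → <⇒≱ xz<yz (*-monoʳ-≤ z 0≤z y≤x)

  *-cancelʳ-≈ : ∀ {x y} z → 0# < z → x * z ≈ y * z → x ≈ y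
  *-cancelʳ-≈ z 0<z eq = ≤-antisym (*-cancelʳ-≤ z 0<z (≤-reflexive eq)) (*-cancelʳ-≤ z 0<z (≤-reflexive (sym eq)))

  ⁻¹-pos : ∀ {x} → 0# < x → 0# < x ⁻¹
  ⁻¹-pos {x} 0<x = *-cancelʳ-< x (<⇒≤ 0<x) (begin-strict
    0# * x     ≈⟨ zeroˡ x ⟩
    0#         <⟨ 0<1 ⟩
    1#         ≈⟨ *-inverseʳ 0<x ⟨
    x * x ⁻¹   ≈⟨ *-comm _ _ ⟩
    x ⁻¹ * x   ∎)

  /-*-cancel : ∀ x {y} → 0# < y → x / y * y ≈ x
  /-*-cancel x {y} 0<y = begin-equality
    x * y ⁻¹ * y    ≈⟨ solve 3 (λ x i y → (x :* i) :* y := x :* (y :* i)) refl x (y ⁻¹) y ⟩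
    x * (y * y ⁻¹)  ≈⟨ *-congˡ (*-inverseʳ 0<y) ⟩
    x * 1#          ≈⟨ *-identityʳ x ⟩
    x               ∎

  ≤⇒≤/ : ∀ {x y z} → 0# < z → x * z ≤ y → x ≤ y / z
  ≤⇒≤/ {x} {y} {z} 0<z h = *-cancelʳ-≤ z 0<z (≤-respʳ-≈ (sym (/-*-cancel y 0<z)) h)

  <⇒</ : ∀ {x y z} → 0# < z → x * z < y → x < y / z
  <⇒</ {x} {y} {z} 0<z h = *-cancelʳ-< z (<⇒≤ 0<z) (<-respʳ-≈ (sym (/-*-cancel y 0<z)) h)

  ≤⇒/≤ : ∀ {x y z} → 0# < z → x ≤ y * z → x / z ≤ y
  ≤⇒/≤ {x} {y} {z} 0<z h = *-cancelʳ-≤ z 0<z (≤-respˡ-≈ (sym (/-*-cancel x 0<z)) h)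

  <⇒/< : ∀ {x y z} → 0# < z → x < y * z → x / z < y
  <⇒/< {x} {y} {z} 0<z h = *-cancelʳ-< z (<⇒≤ 0<z) (<-respˡ-≈ (sym (/-*-cancel x 0<z)) h)

  /-pos : ∀ {x y} → 0# < x → 0# < y → 0# < x / y
  /-pos 0<x 0<y = *-pos 0<x (⁻¹-pos 0<y)

  square-cancel-≤ : ∀ {x y} → 0# ≤ y → x * x ≤ y * y → x ≤ y
  square-cancel-≤ {x} {y} 0≤y h = ≮⇒≥ λ y<x → <⇒≱ (begin-strict
    y * y  ≤⟨ *-monoˡ-≤ y 0≤y (<⇒≤ y<x) ⟩
    y * x  <⟨ *-monoʳ-< x (≤-<-trans 0≤y y<x) y<x ⟩
    x * x  ∎) h

  square-cancel-< : ∀ {x y} → 0# ≤ y → x * x < y * y → x < y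
  square-cancel-< {x} {y} 0≤y h = ≰⇒> λ y≤x → <⇒≱ h (*-mono-≤ 0≤y 0≤y y≤x y≤x)

  fromℕ-+ : ∀ m n → fromℕ (m ℕ.+ n) ≈ fromℕ m + fromℕ n
  fromℕ-+ = ×-homo-+ 1#

  fromℕ-* : ∀ m n → fromℕ (m ℕ.* n) ≈ fromℕ m * fromℕ n
  fromℕ-* = ×1-homo-*

  fromℕ-^ : ∀ m n → fromℕ (m ℕ.^ n) ≈ fromℕ m ^ n
  fromℕ-^ m zero    = +-identityʳ 1#
  fromℕ-^ m (suc n) = trans (fromℕ-* m (m ℕ.^ n)) (*-congˡ (fromℕ-^ m n))

  0≤fromℕ : ∀ n → 0# ≤ fromℕ n
  0≤fromℕ zero    = ≤-refl
  0≤fromℕ (suc n) = +-nonNeg 0≤1 (0≤fromℕ n)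

  fromℕ-mono-≤ : ∀ {m n} → m ℕ.≤ n → fromℕ m ≤ fromℕ n
  fromℕ-mono-≤ {n = n} ℕ.z≤n = 0≤fromℕ n
  fromℕ-mono-≤ (ℕ.s≤s m≤n)   = +-mono-≤ ≤-refl (fromℕ-mono-≤ m≤n)

  fromℕ-step : ∀ n → fromℕ n < fromℕ (suc n)
  fromℕ-step n = <-diff 0<1 (solve 1 (λ n → c1 := (c1 :+ n) :- n) refl (fromℕ n))

  fromℕ-mono-< : ∀ {m n} → m ℕ.< n → fromℕ m < fromℕ n
  fromℕ-mono-< {m} m<n = <-≤-trans (fromℕ-step m) (fromℕ-mono-≤ m<n)

  fromℕ-cancel-≤ : ∀ {m n} → fromℕ m ≤ fromℕ n → m ℕ.≤ n
  fromℕ-cancel-≤ h = ℕ.≮⇒≥ λ n<m → <⇒≱ (fromℕ-mono-< n<m) h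

  fromℕ-cancel-< : ∀ {m n} → fromℕ m < fromℕ n → m ℕ.< n
  fromℕ-cancel-< h = ℕ.≰⇒> λ n≤m → <⇒≱ h (fromℕ-mono-≤ n≤m)

  fromℕ-pos : ∀ n .{{_ : ℕ.NonZero n}} → 0# < fromℕ n
  fromℕ-pos (suc n) = fromℕ-mono-< {0} {suc n} (ℕ.s≤s ℕ.z≤n)

  -- If x bounded all naturals they would have a supremum s. But n + 1 ≤ s for every n makes
  -- `s - 1#` a smaller upper bound.
  archimedean : ∀ x → ∃ λ n → x < fromℕ n
  archimedean x with em {P = ∃ λ n → x < fromℕ n}
  ... | yes p = p
  ... | no ¬p = ⊥-elim (<⇒≱ (<-diff 0<1 (solve 1 (λ s → c1 := s :- (s :- c1)) refl s)) (least (s - 1#) ub))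
    where
    P : ℝ → Set
    P y = ∃ λ n → y ≈ fromℕ n
    sup = complete P (fromℕ 0 , 0 , refl) (x , λ y (n , y≈n) → ≤-respˡ-≈ (sym y≈n) (≮⇒≥ λ x<n → ¬p (n , x<n)))
    s = proj₁ sup
    least = proj₂ (proj₂ sup)
    ub : UpperBound P (s - 1#)
    ub y (n , y≈n) = ≤-respˡ-≈ (sym y≈n)
      (≤-diff (x≤y⇒0≤y-x (proj₁ (proj₂ sup) (fromℕ (suc n)) (suc n , refl)))
        (solve 2 (λ s n → s :- (c1 :+ n) := (s :- c1) :- n) refl s (fromℕ n)))

  natFloor : ∀ {x} → 0# ≤ x → ∃ λ n → fromℕ n ≤ x × x < fromℕ (suc n)
  natFloor {x} 0≤x = search (proj₁ (archimedean x)) (proj₂ (archimedean x))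
    where
    search : ∀ n → x < fromℕ n → ∃ λ n → fromℕ n ≤ x × x < fromℕ (suc n)
    search zero    x<0 = ⊥-elim (<⇒≱ x<0 0≤x)
    search (suc n) x<n with em {P = x < fromℕ n}
    ... | yes h = search n h
    ... | no  h = n , ≮⇒≥ h , x<n

-- Limits of real sequences

module Limits (em : ExcludedMiddle 0ℓ) (R : CompleteOrderedField) where

  open OrderedFieldSolver em R
  open OrderedField em R

  open ≤-Reasoning

  infix 4 _≼_

  -- x ≼ u stands for ∣ x ∣ ≤ u.
  _≼_ : ℝ → ℝ → Set
  x ≼ u = x ≤ u × - x ≤ u

  ∣∣-elim : ∀ {x u} → ∣ x ∣ ≤ u → x ≼ u
  ∣∣-elim {x} {u} h with ≤-total 0# x
  ... | inj₁ 0≤x = h , ≤-trans (≤-trans (neg-mono-≤ 0≤x) (≤-trans (≤-reflexive -0#≈0#) 0≤x)) h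
  ... | inj₂ x≤0 = ≤-trans (≤-trans x≤0 (≤-trans (≤-reflexive (sym -0#≈0#)) (neg-mono-≤ x≤0))) h , h

  ∣∣-intro : ∀ {x u} → x ≼ u → ∣ x ∣ ≤ u
  ∣∣-intro {x} (x≤u , -x≤u) with ≤-total 0# x
  ... | inj₁ _ = x≤u
  ... | inj₂ _ = -x≤u

  ≼-resp : ∀ {x y u v} → x ≈ y → u ≈ v → x ≼ u → y ≼ v
  ≼-resp x≈y u≈v (p , q) = ≤-respˡ-≈ x≈y (≤-respʳ-≈ u≈v p) , ≤-respˡ-≈ (-‿cong x≈y) (≤-respʳ-≈ u≈v q)

  ≼-trans : ∀ {x u v} → x ≼ u → u ≤ v → x ≼ v
  ≼-trans (p , q) u≤v = ≤-trans p u≤v , ≤-trans q u≤v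

  ≼-refl : ∀ {u} → 0# ≤ u → u ≼ u
  ≼-refl 0≤u = ≤-refl , ≤-trans (neg-mono-≤ 0≤u) (≤-trans (≤-reflexive -0#≈0#) 0≤u)

  ≼-+ : ∀ {x y u v} → x ≼ u → y ≼ v → x + y ≼ u + v
  ≼-+ {x} {y} (p , q) (p′ , q′) = +-mono-≤ p p′ ,
    ≤-respˡ-≈ (solve 2 (λ x y → :- x :+ :- y := :- (x :+ y)) refl x y) (+-mono-≤ q q′)

  ≼-abs : ∀ x → ∃ λ u → 0# ≤ u × x ≼ u
  ≼-abs x with ≤-total 0# x
  ... | inj₁ 0≤x = x , 0≤x , ≼-refl 0≤x
  ... | inj₂ x≤0 = - x , 0≤-x , ≤-trans x≤0 0≤-x , ≤-refl
    where 0≤-x = ≤-respˡ-≈ -0#≈0# (neg-mono-≤ x≤0)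

  2# : ℝ
  2# = fromℕ 2

  0<2 : 0# < 2#
  0<2 = fromℕ-pos 2

  half : ℝ → ℝ
  half x = x / 2#

  half-+ : ∀ x → half x + half x ≈ x
  half-+ x = trans (solve 1 (λ h → h :+ h := h :* c2) refl (half x)) (/-*-cancel x 0<2)

  half-pos : ∀ {x} → 0# < x → 0# < half x
  half-pos 0<x = /-pos 0<x 0<2

  ≼-nonNeg : ∀ {x u} → x ≼ u → 0# ≤ u
  ≼-nonNeg {x} {u} (p , q) = *-cancelʳ-≤ 2# 0<2 (≤-diff (+-nonNeg (x≤y⇒0≤y-x p) (x≤y⇒0≤y-x q))
    (solve 2 (λ x u → (u :- x) :+ (u :- (:- x)) := u :* c2 :- c0 :* c2) refl x u))

  -- Twice uv - xy is (u - x)(v + y) + (u + x)(v - y), and twice uv + xy is (u - x)(v - y) + (u +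
  -- x)(v + y). All four factors are nonnegative, so no case distinction on signs arises.
  ≼-* : ∀ {x y u v} → x ≼ u → y ≼ v → x * y ≼ u * v
  ≼-* {x} {y} {u} {v} (x≤u , -x≤u) (y≤v , -y≤v) =
      *-cancelʳ-≤ 2# 0<2 (≤-diff (+-nonNeg (*-nonNeg h₁ h₄) (*-nonNeg h₂ h₃))
        (solve 4 (λ x y u v → (u :- x) :* (v :- (:- y)) :+ (u :- (:- x)) :* (v :- y) := (u :* v) :* c2 :- (x :* y) :* c2)
          refl x y u v))
    , *-cancelʳ-≤ 2# 0<2 (≤-diff (+-nonNeg (*-nonNeg h₁ h₃) (*-nonNeg h₂ h₄))
        (solve 4 (λ x y u v → (u :- x) :* (v :- y) :+ (u :- (:- x)) :* (v :- (:- y)) := (u :* v) :* c2 :- (:- (x :* y)) :* c2)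
          refl x y u v))
    where
    h₁ = x≤y⇒0≤y-x x≤u
    h₂ = x≤y⇒0≤y-x -x≤u
    h₃ = x≤y⇒0≤y-x y≤v
    h₄ = x≤y⇒0≤y-x -y≤v

  close : ∀ {a x} → a ⟶ x → ∀ ε → 0# < ε → ∃ λ N → ∀ n → N ℕ.≤ n → a n - x ≼ ε
  close a⟶x ε 0<ε = proj₁ (a⟶x ε 0<ε) , λ n N≤n → ∣∣-elim (proj₂ (a⟶x ε 0<ε) n N≤n)

  converges : ∀ {a x} → (∀ ε → 0# < ε → ∃ λ N → ∀ n → N ℕ.≤ n → a n - x ≼ ε) → a ⟶ x
  converges h ε 0<ε = proj₁ (h ε 0<ε) , λ n N≤n → ∣∣-intro (proj₂ (h ε 0<ε) n N≤n)

  ⟶-cong : ∀ {a b x y} → (∀ n → a n ≈ b n) → x ≈ y → a ⟶ x → b ⟶ y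
  ⟶-cong a≈b x≈y a⟶x = converges λ ε 0<ε → proj₁ (close a⟶x ε 0<ε) , λ n N≤n →
    ≼-resp (+-cong (a≈b n) (-‿cong x≈y)) refl (proj₂ (close a⟶x ε 0<ε) n N≤n)

  ⟶-const : ∀ x → (λ _ → x) ⟶ x
  ⟶-const x = converges λ ε 0<ε → 0 , λ _ _ → ≼-resp (sym (-‿inverseʳ x)) refl
    (<⇒≤ 0<ε , ≤-respˡ-≈ (sym -0#≈0#) (<⇒≤ 0<ε))

  ⟶-squeeze : ∀ {a b c x} → b ⟶ x → (∀ n → a n - b n ≼ c n) → c ⟶ 0# → a ⟶ x
  ⟶-squeeze {a} {b} {c} {x} b⟶x h c⟶0 = converges λ ε 0<ε →
    let (N , p) = close b⟶x (half ε) (half-pos 0<ε)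
        (M , q) = close c⟶0 (half ε) (half-pos 0<ε)
    in N ℕ.+ M , λ n le → ≼-resp (solve 3 (λ a b x → (a :- b) :+ (b :- x) := a :- x) refl (a n) (b n) x) (half-+ ε)
         (≼-+ (≼-trans (h n) (≤-respˡ-≈ (solve 1 (λ c → c :- c0 := c) refl (c n)) (proj₁ (q n (ℕ.≤-trans (ℕ.m≤n+m M N) le)))))
              (p n (ℕ.≤-trans (ℕ.m≤m+n N M) le)))

  ⟶-+ : ∀ {a b x y} → a ⟶ x → b ⟶ y → (λ n → a n + b n) ⟶ (x + y)
  ⟶-+ {a} {b} {x} {y} a⟶x b⟶y = converges λ ε 0<ε →
    let (N , p) = close a⟶x (half ε) (half-pos 0<ε)
        (M , q) = close b⟶y (half ε) (half-pos 0<ε)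
    in N ℕ.+ M , λ n le → ≼-resp (solve 4 (λ a b x y → (a :- x) :+ (b :- y) := (a :+ b) :- (x :+ y)) refl (a n) (b n) x y) (half-+ ε)
         (≼-+ (p n (ℕ.≤-trans (ℕ.m≤m+n N M) le)) (q n (ℕ.≤-trans (ℕ.m≤n+m M N) le)))

  ⟶-neg : ∀ {a x} → a ⟶ x → (λ n → - a n) ⟶ (- x)
  ⟶-neg {a} {x} a⟶x = converges λ ε 0<ε →
    let (N , p) = close a⟶x ε 0<ε
    in N , λ n le →
         ≤-respˡ-≈ (solve 2 (λ a x → :- (a :- x) := :- a :- (:- x)) refl (a n) x) (proj₂ (p n le)) ,
         ≤-respˡ-≈ (solve 2 (λ a x → a :- x := :- (:- a :- (:- x))) refl (a n) x) (proj₁ (p n le))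

  ⟶-* : ∀ {a b x y} → a ⟶ x → b ⟶ y → (λ n → a n * b n) ⟶ (x * y)
  ⟶-* {a} {b} {x} {y} a⟶x b⟶y = converges λ ε 0<ε →
    let (u , 0≤u , x≼u) = ≼-abs x
        (v , 0≤v , y≼v) = ≼-abs y
        w = 1# + u + v
        0<w : 0# < w
        0<w = +-pos (+-pos 0<1 0≤u) 0≤v
        0<w+ε = +-pos 0<w (<⇒≤ 0<ε)
        -- δ ≤ 1 and δ (1 + u + v) ≤ ε
        δ = ε / (w + ε)
        0<δ = /-pos 0<ε 0<w+ε
        (N , p) = close a⟶x δ 0<δ
        (M , q) = close b⟶y δ 0<δ
        eq = /-*-cancel ε 0<w+ε
        δ≤1 : δ ≤ 1#
        δ≤1 = ≤⇒/≤ 0<w+ε (≤-diff (<⇒≤ 0<w) (solve 2 (λ w ε → w := c1 :* (w :+ ε) :- ε) refl w ε))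
        bound : δ * δ + u * δ + δ * v ≤ ε
        bound = begin
          δ * δ + u * δ + δ * v       ≤⟨ +-mono-≤ (+-mono-≤ (*-monoˡ-≤ δ (<⇒≤ 0<δ) δ≤1) ≤-refl) ≤-refl ⟩
          δ * 1# + u * δ + δ * v      ≈⟨ solve 3 (λ δ u v → δ :* c1 :+ u :* δ :+ δ :* v := δ :* (c1 :+ u :+ v)) refl δ u v ⟩
          δ * w                       ≤⟨ *-monoˡ-≤ δ (<⇒≤ 0<δ) (≤-diff (<⇒≤ 0<ε) (solve 2 (λ w ε → ε := (w :+ ε) :- w) refl w ε)) ⟩
          δ * (w + ε)                 ≈⟨ eq ⟩
          ε                           ∎
    in N ℕ.+ M , λ n le →
         let pn = p n (ℕ.≤-trans (ℕ.m≤m+n N M) le)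
             qn = q n (ℕ.≤-trans (ℕ.m≤n+m M N) le)
         in ≼-trans (≼-resp (solve 4 (λ a b x y → (a :- x) :* (b :- y) :+ x :* (b :- y) :+ (a :- x) :* y := a :* b :- x :* y) refl (a n) (b n) x y) refl
              (≼-+ (≼-+ (≼-* pn qn) (≼-* x≼u qn)) (≼-* pn y≼v))) bound

  ⟶-mono : ∀ {a b x y} → a ⟶ x → b ⟶ y → ∀ K → (∀ n → K ℕ.≤ n → a n ≤ b n) → x ≤ y
  ⟶-mono {a} {b} {x} {y} a⟶x b⟶y K a≤b = ≮⇒≥ λ y<x →
    -- A quarter of the gap: each sequence may deviate by it, and half of the gap still remains.
    let ε = half (half (x - y))
        0<ε = half-pos (half-pos (x<y⇒0<y-x y<x))
        (N , p) = close a⟶x ε 0<ε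
        (M , q) = close b⟶y ε 0<ε
        n = K ℕ.+ (N ℕ.+ M)
        an = proj₂ (p n (ℕ.≤-trans (ℕ.m≤m+n N M) (ℕ.m≤n+m (N ℕ.+ M) K)))
        bn = proj₁ (q n (ℕ.≤-trans (ℕ.m≤n+m M N) (ℕ.m≤n+m (N ℕ.+ M) K)))
    in <⇒≱ (half-pos (x<y⇒0<y-x y<x)) (≤-diff
         (+-nonNeg (+-nonNeg (x≤y⇒0≤y-x an) (x≤y⇒0≤y-x bn)) (x≤y⇒0≤y-x (a≤b n (ℕ.m≤m+n K _))))
         (begin-equality
           (ε - - (a n - x)) + (ε - (b n - y)) + (b n - a n)
               ≈⟨ solve 5 (λ ε a b x y → (ε :- (:- (a :- x))) :+ (ε :- (b :- y)) :+ (b :- a) := (ε :+ ε) :- (x :- y)) refl ε (a n) (b n) x y ⟩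
           (ε + ε) - (x - y)              ≈⟨ +-cong (half-+ _) (-‿cong (sym (half-+ (x - y)))) ⟩
           h - (h + h)                    ≈⟨ solve 1 (λ h → h :- (h :+ h) := c0 :- h) refl h ⟩
           0# - h                         ∎))
    where h = half (x - y)

  ⟶-unique : ∀ {a x y} → a ⟶ x → a ⟶ y → x ≈ y
  ⟶-unique p q = ≤-antisym (⟶-mono p q 0 (λ _ _ → ≤-refl)) (⟶-mono q p 0 (λ _ _ → ≤-refl))

  lim-eq : ∀ {a x} → a ⟶ x → lim a ≈ x
  lim-eq {a} {x} a⟶x with em {P = ∃ (a ⟶_)}
  ... | yes (_ , a⟶y) = ⟶-unique a⟶y a⟶x
  ... | no  ¬p        = ⊥-elim (¬p (x , a⟶x))

  increasing : ∀ {a : ℕ → ℝ} → (∀ n → a n ≤ a (suc n)) → ∀ {m n} → m ℕ.≤ n → a m ≤ a n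
  increasing {a} step {m} m≤n = go (ℕ.≤⇒≤′ m≤n)
    where
    go : ∀ {n} → m ℕ.≤′ n → a m ≤ a n
    go ℕ.≤′-refl     = ≤-refl
    go (ℕ.≤′-step p) = ≤-trans (go p) (step _)

  monotoneConvergence : ∀ {a b} → (∀ n → a n ≤ a (suc n)) → (∀ n → a n ≤ b) → ∃ λ x → a ⟶ x × (∀ n → a n ≤ x)
  monotoneConvergence {a} {b} step bound = s , converges conv , λ n → ub (a n) (n , refl)
    where
    sup = complete (λ y → ∃ λ n → y ≈ a n) (a 0 , 0 , refl) (b , λ y (n , eq) → ≤-respˡ-≈ (sym eq) (bound n))
    s = proj₁ sup
    ub = proj₁ (proj₂ sup)
    conv : ∀ ε → 0# < ε → ∃ λ N → ∀ n → N ℕ.≤ n → a n - s ≼ ε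
    conv ε 0<ε with em {P = ∃ λ n → s - ε < a n}
    ... | no  ¬p = ⊥-elim (<⇒≱ (<-diff 0<ε (solve 2 (λ s ε → ε := s :- (s :- ε)) refl s ε))
                     (proj₂ (proj₂ sup) (s - ε) λ y (n , eq) → ≤-respˡ-≈ (sym eq) (≮⇒≥ λ lt → ¬p (n , lt))))
    ... | yes (N , s-ε<aN) = N , λ n N≤n →
            ≤-diff (+-nonNeg (x≤y⇒0≤y-x (ub (a n) (n , refl))) (<⇒≤ 0<ε))
              (solve 3 (λ s a ε → (s :- a) :+ ε := ε :- (a :- s)) refl s (a n) ε) ,
            ≤-diff (x≤y⇒0≤y-x (≤-trans (<⇒≤ s-ε<aN) (increasing step N≤n)))
              (solve 3 (λ s a ε → a :- (s :- ε) := ε :- (:- (a :- s))) refl s (a n) ε)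

-- The exponential series: convergence and the addition law

module ExponentialSeries (em : ExcludedMiddle 0ℓ) (R : CompleteOrderedField) where

  open OrderedFieldSolver em R
  open OrderedField em R
  open Limits em R

  open ≤-Reasoning

  sum : (ℕ → ℝ) → ℕ → ℝ
  sum g zero    = 0#
  sum g (suc n) = sum g n + g n

  sum-cong : ∀ {g h} n → (∀ i → i ℕ.< n → g i ≈ h i) → sum g n ≈ sum h n
  sum-cong zero    eq = refl
  sum-cong (suc n) eq = +-cong (sum-cong n λ i i<n → eq i (ℕ.m<n⇒m<1+n i<n)) (eq n ℕ.≤-refl)

  sum-+ : ∀ g h n → sum (λ i → g i + h i) n ≈ sum g n + sum h n
  sum-+ g h zero    = sym (+-identityˡ 0#)
  sum-+ g h (suc n) = trans (+-congʳ (sum-+ g h n))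
    (solve 4 (λ a b c d → (a :+ b) :+ (c :+ d) := (a :+ c) :+ (b :+ d)) refl (sum g n) (sum h n) (g n) (h n))

  sum-*ˡ : ∀ c g n → sum (λ i → c * g i) n ≈ c * sum g n
  sum-*ˡ c g zero    = sym (zeroʳ c)
  sum-*ˡ c g (suc n) = trans (+-congʳ (sum-*ˡ c g n)) (sym (distribˡ c _ _))

  sum-*ʳ : ∀ g c n → sum (λ i → g i * c) n ≈ sum g n * c
  sum-*ʳ g c zero    = sym (zeroˡ c)
  sum-*ʳ g c (suc n) = trans (+-congʳ (sum-*ʳ g c n)) (sym (distribʳ c _ _))

  sum-suc : ∀ g n → sum g (suc n) ≈ g 0 + sum (λ i → g (suc i)) n
  sum-suc g zero    = +-comm _ _
  sum-suc g (suc n) = trans (+-congʳ (sum-suc g n)) (+-assoc _ _ _)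

  sum-≼ : ∀ {g h} n → (∀ i → i ℕ.< n → g i ≼ h i) → sum g n ≼ sum h n
  sum-≼ zero    _ = ≼-refl ≤-refl
  sum-≼ (suc n) p = ≼-+ (sum-≼ n λ i i<n → p i (ℕ.m<n⇒m<1+n i<n)) (p n ℕ.≤-refl)

  sum-mono-≤ : ∀ {g h} n → (∀ i → i ℕ.< n → g i ≤ h i) → sum g n ≤ sum h n
  sum-mono-≤ zero    _ = ≤-refl
  sum-mono-≤ (suc n) p = +-mono-≤ (sum-mono-≤ n λ i i<n → p i (ℕ.m<n⇒m<1+n i<n)) (p n ℕ.≤-refl)

  sum-monoˡ-≤ : ∀ {g} → (∀ i → 0# ≤ g i) → ∀ {m n} → m ℕ.≤ n → sum g m ≤ sum g n
  sum-monoˡ-≤ {g} 0≤g = increasing λ n → ≤-diff (0≤g n) (solve 2 (λ s t → t := (s :+ t) :- s) refl (sum g n) (g n))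

  term : ℝ → ℕ → ℝ
  term x n = (x ^ n) / fromℕ (n !)

  0<n! : ∀ n → 0# < fromℕ (n !)
  0<n! n = fromℕ-pos (n !) {{n ℕ.!≢0}}

  term-zero : ∀ x → term x 0 ≈ 1#
  term-zero x = begin-equality
    1# * (1# + 0#) ⁻¹         ≈⟨ *-identityˡ _ ⟩
    fromℕ 1 ⁻¹                ≈⟨ solve 1 (λ i → i := (c1 :+ c0) :* i) refl _ ⟩
    fromℕ 1 * fromℕ 1 ⁻¹      ≈⟨ *-inverseʳ (fromℕ-pos 1) ⟩
    1#                        ∎

  -- The division-free recurrence of the series. Every later fact about terms is proved by
  -- multiplying through by n + 1 and applying it.
  term-suc : ∀ x n → fromℕ (suc n) * term x (suc n) ≈ x * term x n
  term-suc x n = *-cancelʳ-≈ F (0<n! n) (begin-equality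
    N * ((x * p) / G) * F        ≈⟨ solve 4 (λ N q i F → N :* (q :* i) :* F := q :* i :* (N :* F)) refl N (x * p) (G ⁻¹) F ⟩
    (x * p) / G * (N * F)        ≈⟨ *-congˡ (fromℕ-* (suc n) (n !)) ⟨
    (x * p) / G * G              ≈⟨ /-*-cancel (x * p) (0<n! (suc n)) ⟩
    x * p                        ≈⟨ *-congˡ (/-*-cancel p (0<n! n)) ⟨
    x * (p / F * F)              ≈⟨ *-assoc _ _ _ ⟨
    x * (p / F) * F              ∎)
    where
    N = fromℕ (suc n)
    F = fromℕ (n !)
    G = fromℕ (suc n !)
    p = x ^ n

  -- Domination by a nonnegative u reduces both convergence and the addition law to arguments that
  -- are not negative.
  term-≼ : ∀ {x u} → x ≼ u → ∀ n → term x n ≼ term u n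
  term-≼ {x} {u} x≼u zero    = ≼-refl (≤-respʳ-≈ (sym (term-zero x)) 0≤1)
  term-≼ {x} {u} x≼u (suc n) = *-cancelʳ-≤ N 0<N (begin
      term x (suc n) * N    ≈⟨ *-comm _ _ ⟩
      N * term x (suc n)    ≈⟨ term-suc x n ⟩
      x * term x n          ≤⟨ proj₁ ih ⟩
      u * term u n          ≈⟨ term-suc u n ⟨
      N * term u (suc n)    ≈⟨ *-comm _ _ ⟩
      term u (suc n) * N    ∎)
    , *-cancelʳ-≤ N 0<N (begin
      - term x (suc n) * N    ≈⟨ solve 2 (λ t N → :- t :* N := :- (N :* t)) refl _ N ⟩
      - (N * term x (suc n))  ≈⟨ -‿cong (term-suc x n) ⟩
      - (x * term x n)        ≤⟨ proj₂ ih ⟩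
      u * term u n            ≈⟨ term-suc u n ⟨
      N * term u (suc n)      ≈⟨ *-comm _ _ ⟩
      term u (suc n) * N      ∎)
    where
    N = fromℕ (suc n)
    0<N = fromℕ-pos (suc n)
    ih : x * term x n ≼ u * term u n
    ih = ≼-* x≼u (term-≼ x≼u n)

  term-nonNeg : ∀ {u} → 0# ≤ u → ∀ n → 0# ≤ term u n
  term-nonNeg 0≤u n = ≼-nonNeg (term-≼ (≼-refl 0≤u) n)

  fromℕ-∸ : ∀ {i k} → i ℕ.≤ k → fromℕ i + fromℕ (k ∸ i) ≈ fromℕ k
  fromℕ-∸ {i} {k} i≤k = trans (sym (fromℕ-+ i (k ∸ i))) (reflexive (≡.cong fromℕ (ℕ.m+[n∸m]≡n i≤k)))

  -- The k-th coefficient of the Cauchy product of the two series.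
  conv : ℝ → ℝ → ℕ → ℝ
  conv x y k = sum (λ i → term x i * term y (k ∸ i)) (suc k)

  -- Both sides satisfy (k + 1) c (k + 1) = (x + y) c k: split the factor k + 1 as i + (k + 1 - i).
  conv-term : ∀ x y k → conv x y k ≈ term (x + y) k
  conv-term x y zero = begin-equality
    0# + term x 0 * term y 0  ≈⟨ +-identityˡ _ ⟩
    term x 0 * term y 0       ≈⟨ *-cong (term-zero x) (term-zero y) ⟩
    1# * 1#                   ≈⟨ *-identityˡ 1# ⟩
    1#                        ≈⟨ term-zero (x + y) ⟨
    term (x + y) 0            ∎
  conv-term x y (suc k) = *-cancelʳ-≈ N (fromℕ-pos (suc k)) (begin-equality
    conv x y (suc k) * N                                 ≈⟨ *-comm _ _ ⟩
    N * conv x y (suc k)                                 ≈⟨ sum-*ˡ N _ (suc (suc k)) ⟨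
    sum (λ i → N * (a i * b (suc k ∸ i))) (suc (suc k))  ≈⟨ sum-cong (suc (suc k)) split ⟩
    sum (λ i → A i + B i) (suc (suc k))                  ≈⟨ sum-+ A B (suc (suc k)) ⟩
    sum A (suc (suc k)) + sum B (suc (suc k))            ≈⟨ +-cong sumA sumB ⟩
    x * conv x y k + y * conv x y k                      ≈⟨ distribʳ _ x y ⟨
    (x + y) * conv x y k                                 ≈⟨ *-congˡ (conv-term x y k) ⟩
    (x + y) * term (x + y) k                             ≈⟨ term-suc (x + y) k ⟨
    N * term (x + y) (suc k)                             ≈⟨ *-comm _ _ ⟩
    term (x + y) (suc k) * N                             ∎)
    where
    N = fromℕ (suc k)
    a = term x
    b = term y
    A B : ℕ → ℝ
    A i = (fromℕ i * a i) * b (suc k ∸ i)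
    B i = a i * (fromℕ (suc k ∸ i) * b (suc k ∸ i))
    split : ∀ i → i ℕ.< suc (suc k) → N * (a i * b (suc k ∸ i)) ≈ A i + B i
    split i (ℕ.s≤s i≤k) = trans (*-congʳ (sym (fromℕ-∸ i≤k)))
      (solve 4 (λ m n s t → (m :+ n) :* (s :* t) := (m :* s) :* t :+ s :* (n :* t)) refl
        (fromℕ i) (fromℕ (suc k ∸ i)) (a i) (b (suc k ∸ i)))
    sumA : sum A (suc (suc k)) ≈ x * conv x y k
    sumA = begin-equality
      sum A (suc (suc k))                             ≈⟨ sum-suc A (suc k) ⟩
      A 0 + sum (λ i → A (suc i)) (suc k)             ≈⟨ +-congʳ (solve 2 (λ s t → (c0 :* s) :* t := c0) refl (a 0) (b (suc k))) ⟩
      0# + sum (λ i → A (suc i)) (suc k)              ≈⟨ +-identityˡ _ ⟩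
      sum (λ i → A (suc i)) (suc k)
          ≈⟨ sum-cong (suc k) (λ i _ → trans (*-congʳ (term-suc x i)) (*-assoc x (a i) _)) ⟩
      sum (λ i → x * (a i * b (k ∸ i))) (suc k)       ≈⟨ sum-*ˡ x _ (suc k) ⟩
      x * conv x y k                                  ∎
    sumB : sum B (suc (suc k)) ≈ y * conv x y k
    sumB = begin-equality
      sum B (suc k) + B (suc k)                       ≈⟨ +-congˡ last ⟩
      sum B (suc k) + 0#                              ≈⟨ +-identityʳ _ ⟩
      sum B (suc k)                                   ≈⟨ sum-cong (suc k) step ⟩
      sum (λ i → y * (a i * b (k ∸ i))) (suc k)       ≈⟨ sum-*ˡ y _ (suc k) ⟩
      y * conv x y k                                  ∎
      where
      last : B (suc k) ≈ 0#
      last rewrite ℕ.n∸n≡0 k = solve 2 (λ s t → s :* (c0 :* t) := c0) refl (a (suc k)) (b 0)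
      step : ∀ i → i ℕ.< suc k → B i ≈ y * (a i * b (k ∸ i))
      step i (ℕ.s≤s i≤k) rewrite ℕ.+-∸-assoc 1 i≤k = trans (*-congˡ (term-suc y (k ∸ i)))
        (solve 3 (λ s y t → s :* (y :* t) := y :* (s :* t)) refl (a i) y (b (k ∸ i)))

  -- Both sides sum `term x i * term y j` over the triangle i + j < n: the left by diagonals, the
  -- right by rows.
  expSum-+ : ∀ x y n → expSum (x + y) n ≈ sum (λ i → term x i * expSum y (n ∸ i)) n
  expSum-+ x y zero    = refl
  expSum-+ x y (suc n) = begin-equality
    expSum (x + y) n + term (x + y) n                     ≈⟨ +-cong (expSum-+ x y n) (sym (conv-term x y n)) ⟩
    sum g n + conv x y n                                  ≈⟨ +-congʳ (+-identityʳ _) ⟨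
    (sum g n + 0#) + conv x y n                           ≈⟨ +-congʳ (+-congˡ last) ⟨
    sum g (suc n) + conv x y n                            ≈⟨ sum-+ g _ (suc n) ⟨
    sum (λ i → g i + term x i * term y (n ∸ i)) (suc n)   ≈⟨ sum-cong (suc n) step ⟩
    sum (λ i → term x i * expSum y (suc n ∸ i)) (suc n)   ∎
    where
    g : ℕ → ℝ
    g i = term x i * expSum y (n ∸ i)
    last : g n ≈ 0#
    last rewrite ℕ.n∸n≡0 n = zeroʳ _
    step : ∀ i → i ℕ.< suc n → g i + term x i * term y (n ∸ i) ≈ term x i * expSum y (suc n ∸ i)
    step i (ℕ.s≤s i≤n) rewrite ℕ.+-∸-assoc 1 i≤n = sym (distribˡ _ _ _)

  expSum≈sum : ∀ x n → expSum x n ≈ sum (term x) n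
  expSum≈sum x zero    = refl
  expSum≈sum x (suc n) = +-congʳ (expSum≈sum x n)

  expSum-* : ∀ x y n → expSum x n * expSum y n ≈ sum (λ i → term x i * expSum y n) n
  expSum-* x y n = trans (*-congʳ (expSum≈sum x n)) (sym (sum-*ʳ (term x) (expSum y n) n))

  expSum-step : ∀ {u} → 0# ≤ u → ∀ n → expSum u n ≤ expSum u (suc n)
  expSum-step {u} 0≤u n = ≤-diff (term-nonNeg 0≤u n) (solve 2 (λ s t → t := (s :+ t) :- s) refl (expSum u n) (term u n))

  expSum-tail-≼ : ∀ {y v} → y ≼ v → ∀ {m n} → m ℕ.≤ n → expSum y n - expSum y m ≼ expSum v n - expSum v m
  expSum-tail-≼ {y} {v} y≼v {m} m≤n = go (ℕ.≤⇒≤′ m≤n)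
    where
    go : ∀ {n} → m ℕ.≤′ n → expSum y n - expSum y m ≼ expSum v n - expSum v m
    go ℕ.≤′-refl     = ≼-resp (sym (-‿inverseʳ _)) (sym (-‿inverseʳ _)) (≼-refl ≤-refl)
    go (ℕ.≤′-step {n} p) =
      ≼-resp (rearrange (expSum y n) (term y n) (expSum y m)) (rearrange (expSum v n) (term v n) (expSum v m)) (≼-+ (go p) (term-≼ y≼v n))
      where
      rearrange : ∀ s t r → (s - r) + t ≈ (s + t) - r
      rearrange = solve 3 (λ s t r → (s :- r) :+ t := (s :+ t) :- r) refl

  -- The products `term x i * term y j` in the square i, j < n but outside the triangle i + j < n.
  -- Being such a sum, it is dominated by the defect of any u and v that dominate x and y.
  defect : ℝ → ℝ → ℕ → ℝ
  defect x y n = expSum x n * expSum y n - expSum (x + y) n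

  defect≈ : ∀ x y n → defect x y n ≈ sum (λ i → term x i * (expSum y n - expSum y (n ∸ i))) n
  defect≈ x y n = begin-equality
    defect x y n                           ≈⟨ +-cong (expSum-* x y n) (-‿cong (expSum-+ x y n)) ⟩
    sum g n - sum h n                      ≈⟨ solve 2 (λ s t → s :- t := s :+ (:- c1) :* t) refl (sum g n) (sum h n) ⟩
    sum g n + - 1# * sum h n               ≈⟨ +-congˡ (sum-*ˡ (- 1#) h n) ⟨
    sum g n + sum (λ i → - 1# * h i) n     ≈⟨ sum-+ g _ n ⟨
    sum (λ i → g i + - 1# * h i) n
        ≈⟨ sum-cong n (λ i _ → solve 3 (λ t p q → t :* p :+ (:- c1) :* (t :* q) := t :* (p :- q)) refl (term x i) (expSum y n) (expSum y (n ∸ i))) ⟩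
    sum (λ i → term x i * (expSum y n - expSum y (n ∸ i))) n ∎
    where
    g h : ℕ → ℝ
    g i = term x i * expSum y n
    h i = term x i * expSum y (n ∸ i)

  defect-≼ : ∀ {x y u v} → x ≼ u → y ≼ v → ∀ n → defect x y n ≼ defect u v n
  defect-≼ {x} {y} {u} {v} x≼u y≼v n = ≼-resp (sym (defect≈ x y n)) (sym (defect≈ u v n))
    (sum-≼ n λ i _ → ≼-* (term-≼ x≼u i) (expSum-tail-≼ y≼v (ℕ.m∸n≤m n i)))

  -- The square i, j < n lies inside the triangle i + j < 2n, and all products are nonnegative.
  expSum-*-≤ : ∀ {u v} → 0# ≤ u → 0# ≤ v → ∀ n → expSum u n * expSum v n ≤ expSum (u + v) (n ℕ.+ n)
  expSum-*-≤ {u} {v} 0≤u 0≤v n = begin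
    expSum u n * expSum v n                                ≈⟨ expSum-* u v n ⟩
    sum (λ i → term u i * expSum v n) n                    ≤⟨ sum-mono-≤ n (λ i i<n → *-monoˡ-≤ _ (term-nonNeg 0≤u i)
                                                                (increasing (expSum-step 0≤v) (n≤2n∸i i i<n))) ⟩
    sum (λ i → term u i * expSum v (n ℕ.+ n ∸ i)) n
        ≤⟨ sum-monoˡ-≤ (λ i → *-nonNeg (term-nonNeg 0≤u i) (increasing (expSum-step 0≤v) {0} {n ℕ.+ n ∸ i} ℕ.z≤n)) (ℕ.m≤m+n n n) ⟩
    sum (λ i → term u i * expSum v (n ℕ.+ n ∸ i)) (n ℕ.+ n) ≈⟨ expSum-+ u v (n ℕ.+ n) ⟨
    expSum (u + v) (n ℕ.+ n)                               ∎
    where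
    n≤2n∸i : ∀ i → i ℕ.< n → n ℕ.≤ n ℕ.+ n ∸ i
    n≤2n∸i i i<n = ℕ.≤-trans (ℕ.m≤m+n n (n ∸ i)) (ℕ.≤-reflexive (≡.sym (ℕ.+-∸-assoc n (ℕ.<⇒≤ i<n))))

  -- From some N on, 2 term (n + 1) ≤ term n, so that expSum + 2 term decreases.
  expSum-bounded : ∀ {u} → 0# ≤ u → ∃ λ b → ∀ n → expSum u n ≤ b
  expSum-bounded {u} 0≤u = potential N , bound
    where
    N = proj₁ (archimedean (2# * u))
    potential : ℕ → ℝ
    potential n = expSum u n + 2# * term u n
    decrease : ∀ n → N ℕ.≤ n → potential (suc n) ≤ potential n
    decrease n N≤n = ≤-diff (x≤y⇒0≤y-x 2t′≤t)
      (solve 3 (λ s t t′ → t :- c2 :* t′ := (s :+ c2 :* t) :- ((s :+ t) :+ c2 :* t′)) refl (expSum u n) (term u n) (term u (suc n)))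
      where
      K = fromℕ (suc n)
      2t′≤t : 2# * term u (suc n) ≤ term u n
      2t′≤t = *-cancelʳ-≤ K (fromℕ-pos (suc n)) (begin
        2# * term u (suc n) * K    ≈⟨ solve 3 (λ c t K → c :* t :* K := c :* (K :* t)) refl 2# (term u (suc n)) K ⟩
        2# * (K * term u (suc n))  ≈⟨ *-congˡ (term-suc u n) ⟩
        2# * (u * term u n)        ≈⟨ *-assoc _ _ _ ⟨
        2# * u * term u n
            ≤⟨ *-monoʳ-≤ _ (term-nonNeg 0≤u n) (≤-trans (<⇒≤ (proj₂ (archimedean (2# * u)))) (fromℕ-mono-≤ (ℕ.m≤n⇒m≤1+n N≤n))) ⟩
        K * term u n               ≈⟨ *-comm _ _ ⟩
        term u n * K               ∎)
    expSum≤potential : ∀ n → expSum u n ≤ potential n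
    expSum≤potential n =
      ≤-diff (*-nonNeg (<⇒≤ 0<2) (term-nonNeg 0≤u n)) (solve 2 (λ s t → t := (s :+ t) :- s) refl (expSum u n) (2# * term u n))
    potential-anti : ∀ {n} → N ℕ.≤′ n → potential n ≤ potential N
    potential-anti ℕ.≤′-refl     = ≤-refl
    potential-anti (ℕ.≤′-step p) = ≤-trans (decrease _ (ℕ.≤′⇒≤ p)) (potential-anti p)
    bound : ∀ n → expSum u n ≤ potential N
    bound n with ℕ.≤-total N n
    ... | inj₁ N≤n = ≤-trans (expSum≤potential n) (potential-anti (ℕ.≤⇒≤′ N≤n))
    ... | inj₂ n≤N = ≤-trans (increasing (expSum-step 0≤u) n≤N) (expSum≤potential N)

  expSum-converges⁺ : ∀ {u} → 0# ≤ u → ∃ λ s → expSum u ⟶ s × (∀ n → expSum u n ≤ s)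
  expSum-converges⁺ 0≤u = monotoneConvergence (expSum-step 0≤u) (proj₂ (expSum-bounded 0≤u))

  -- For x of either sign, expSum x + expSum u is increasing and bounded as soon as ∣ x ∣ ≤ u.
  expSum-converges : ∀ x → ∃ λ s → expSum x ⟶ s
  expSum-converges x =
    let (u , 0≤u , x≼u) = ≼-abs x
        (t , S⟶t , S≤t) = expSum-converges⁺ 0≤u
        (s , c , _) = monotoneConvergence {λ n → expSum x n + expSum u n} {t + t}
          (λ n → ≤-diff (x≤y⇒0≤y-x (proj₂ (term-≼ x≼u n)))
            (solve 4 (λ a b s t → b :- (:- a) := ((s :+ a) :+ (t :+ b)) :- (s :+ t)) refl (term x n) (term u n) (expSum x n) (expSum u n)))
          (λ n → +-mono-≤ (≤-trans (expSum-≤ x≼u n) (S≤t n)) (S≤t n))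
    in s + - t , ⟶-cong (λ n → solve 2 (λ a b → (a :+ b) :+ (:- b) := a) refl (expSum x n) (expSum u n)) refl (⟶-+ c (⟶-neg S⟶t))
    where
    expSum-≤ : ∀ {u} → x ≼ u → ∀ n → expSum x n ≤ expSum u n
    expSum-≤ x≼u zero    = ≤-refl
    expSum-≤ x≼u (suc n) = +-mono-≤ (expSum-≤ x≼u n) (proj₁ (term-≼ x≼u n))

  exp-limit : ∀ x → expSum x ⟶ exp x
  exp-limit x = ⟶-cong (λ _ → refl) (sym (lim-eq (proj₂ (expSum-converges x)))) (proj₂ (expSum-converges x))

  -- The square sum is at most the limit s of `expSum (u + v)`, so the defect lies between 0 and s -
  -- `expSum (u + v) n`, which tends to 0.
  defect⟶0⁺ : ∀ {u v} → 0# ≤ u → 0# ≤ v → defect u v ⟶ 0#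
  defect⟶0⁺ {u} {v} 0≤u 0≤v =
    let (s , S⟶s , S≤s) = expSum-converges⁺ (+-nonNeg 0≤u 0≤v)
    in ⟶-squeeze {c = λ n → s - expSum (u + v) n} (⟶-const 0#)
         (λ n → let up = ≤-trans (expSum-*-≤ 0≤u 0≤v n) (S≤s (n ℕ.+ n))
                    p = expSum u n * expSum v n ; q = expSum (u + v) n
                in ≼-trans (≼-resp (solve 1 (λ d → d := d :- c0) refl (defect u v n)) refl (≼-refl (≼-nonNeg (defect-≼ (≼-refl 0≤u) (≼-refl 0≤v) n))))
                     (≤-diff (x≤y⇒0≤y-x up) (solve 3 (λ s p q → s :- p := (s :- q) :- (p :- q)) refl s p q)))
         (⟶-cong (λ _ → refl) (-‿inverseʳ s) (⟶-+ (⟶-const s) (⟶-neg S⟶s)))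

  exp-+ : ∀ x y → exp (x + y) ≈ exp x * exp y
  exp-+ x y =
    let (u , 0≤u , x≼u) = ≼-abs x
        (v , 0≤v , y≼v) = ≼-abs y
    in lim-eq (⟶-squeeze {c = defect u v} (⟶-* (exp-limit x) (exp-limit y))
         (λ n → let (p , q) = defect-≼ x≼u y≼v n
                    eq = solve 2 (λ s t → :- (s :- t) := t :- s) refl (expSum x n * expSum y n) (expSum (x + y) n)
                in ≤-respˡ-≈ eq q , ≤-respˡ-≈ (trans (sym (-‿involutive _)) (-‿cong eq)) p)
         (defect⟶0⁺ 0≤u 0≤v))

-- Exponential, logarithm, square root, rounding, and the values of f

module ExpLog (em : ExcludedMiddle 0ℓ) (R : CompleteOrderedField) where

  open OrderedFieldSolver em R
  open OrderedField em R
  open Limits em R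
  open ExponentialSeries em R

  open ≤-Reasoning

  expSum-cong : ∀ {x y} → x ≈ y → ∀ n → expSum x n ≈ expSum y n
  expSum-cong x≈y zero    = refl
  expSum-cong x≈y (suc n) = +-cong (expSum-cong x≈y n) (*-congʳ (^-congˡ n x≈y))

  exp-cong : ∀ {x y} → x ≈ y → exp x ≈ exp y
  exp-cong {x} {y} x≈y = lim-eq (⟶-cong (λ n → sym (expSum-cong x≈y n)) refl (exp-limit y))

  1+x≤exp : ∀ {x} → 0# ≤ x → 1# + x ≤ exp x
  1+x≤exp {x} 0≤x = ⟶-mono (⟶-const (1# + x)) (exp-limit x) 2 λ n 2≤n → begin
    1# + x                         ≈⟨ +-cong (term-zero x) term-one ⟨
    term x 0 + term x 1            ≈⟨ +-congʳ (+-identityˡ _) ⟨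
    expSum x 2                     ≤⟨ increasing (expSum-step 0≤x) 2≤n ⟩
    expSum x n                     ∎
    where
    term-one : term x 1 ≈ x
    term-one = begin-equality
      term x 1              ≈⟨ solve 1 (λ t → t := (c1 :+ c0) :* t) refl (term x 1) ⟩
      fromℕ 1 * term x 1    ≈⟨ term-suc x 0 ⟩
      x * term x 0          ≈⟨ *-congˡ (term-zero x) ⟩
      x * 1#                ≈⟨ *-identityʳ x ⟩
      x                     ∎

  -- By the addition law it is idempotent, and by `1+x≤exp` it is positive.
  exp-0 : exp 0# ≈ 1#
  exp-0 = *-cancelʳ-≈ (exp 0#) 0<e (begin-equality
    exp 0# * exp 0#  ≈⟨ exp-+ 0# 0# ⟨
    exp (0# + 0#)    ≈⟨ exp-cong (+-identityˡ 0#) ⟩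
    exp 0#           ≈⟨ *-identityˡ _ ⟨
    1# * exp 0#      ∎)
    where
    0<e : 0# < exp 0#
    0<e = <-≤-trans (<-respʳ-≈ (sym (+-identityʳ 1#)) 0<1) (1+x≤exp ≤-refl)

  exp-inverse : ∀ x → exp x * exp (- x) ≈ 1#
  exp-inverse x = trans (sym (exp-+ x (- x))) (trans (exp-cong (-‿inverseʳ x)) exp-0)

  -- It is the square of exp (x / 2), and nonzero because exp (- x) inverts it.
  exp-pos : ∀ x → 0# < exp x
  exp-pos x = nonNeg , λ 0≈e → 0≉1 (begin-equality
    0#                  ≈⟨ zeroˡ _ ⟨
    0# * exp (- x)      ≈⟨ *-congʳ 0≈e ⟩
    exp x * exp (- x)   ≈⟨ exp-inverse x ⟩
    1#                  ∎)
    where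
    nonNeg : 0# ≤ exp x
    nonNeg = ≤-respʳ-≈ (trans (sym (exp-+ (half x) (half x))) (exp-cong (half-+ x))) (square-nonNeg (exp (half x)))

  exp-split : ∀ x y → exp y ≈ exp x * exp (y - x)
  exp-split x y = trans (exp-cong (solve 2 (λ x y → y := x :+ (y :- x)) refl x y)) (exp-+ x (y - x))

  exp-mono-< : ∀ {x y} → x < y → exp x < exp y
  exp-mono-< {x} {y} x<y = begin-strict
    exp x                   ≈⟨ *-identityʳ _ ⟨
    exp x * 1#
        <⟨ *-monoˡ-< _ (exp-pos x) (<-diff (x<y⇒0<y-x x<y) (solve 1 (λ d → d := (c1 :+ d) :- c1) refl (y - x))) ⟩
    exp x * (1# + (y - x))  ≤⟨ *-monoˡ-≤ _ (<⇒≤ (exp-pos x)) (1+x≤exp (x≤y⇒0≤y-x (<⇒≤ x<y))) ⟩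
    exp x * exp (y - x)     ≈⟨ exp-split x y ⟨
    exp y                   ∎

  exp-cancel-≤ : ∀ {x y} → exp x ≤ exp y → x ≤ y
  exp-cancel-≤ h = ≮⇒≥ λ y<x → <⇒≱ (exp-mono-< y<x) h

  exp-injective : ∀ {x y} → exp x ≈ exp y → x ≈ y
  exp-injective eq = ≤-antisym (exp-cancel-≤ (≤-reflexive eq)) (exp-cancel-≤ (≤-reflexive (sym eq)))

  exp-mono-≤ : ∀ {x y} → x ≤ y → exp x ≤ exp y
  exp-mono-≤ {x} {y} x≤y with em {P = x ≈ y}
  ... | yes x≈y = ≤-reflexive (exp-cong x≈y)
  ... | no  x≉y = <⇒≤ (exp-mono-< (x≤y , x≉y))

  -- Compare the series with the geometric one.
  exp-*[1-x]≤1 : ∀ {x} → 0# ≤ x → x ≤ 1# → exp x * (1# - x) ≤ 1#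
  exp-*[1-x]≤1 {x} 0≤x x≤1 = ⟶-mono (⟶-* (exp-limit x) (⟶-const (1# - x))) (⟶-const 1#) 0 λ n _ →
    ≤-trans (geometric n) (≤-diff (power-nonNeg n) (solve 1 (λ p → p := c1 :- (c1 :- p)) refl (x ^ n)))
    where
    power-nonNeg : ∀ n → 0# ≤ x ^ n
    power-nonNeg zero    = 0≤1
    power-nonNeg (suc n) = *-nonNeg 0≤x (power-nonNeg n)
    term≤power : ∀ n → term x n ≤ x ^ n
    term≤power n = ≤⇒/≤ (0<n! n) (≤-respˡ-≈ (*-identityʳ _) (*-monoˡ-≤ _ (power-nonNeg n)
      (≤-respˡ-≈ (+-identityʳ 1#) (fromℕ-mono-≤ (ℕ.1≤n! n)))))
    geometric : ∀ n → expSum x n * (1# - x) ≤ 1# - x ^ n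
    geometric zero    = ≤-reflexive (solve 1 (λ x → c0 :* (c1 :- x) := c1 :- c1) refl x)
    geometric (suc n) = begin
      (expSum x n + term x n) * (1# - x)             ≈⟨ distribʳ _ _ _ ⟩
      expSum x n * (1# - x) + term x n * (1# - x)    ≤⟨ +-mono-≤ (geometric n) (*-monoʳ-≤ _ (x≤y⇒0≤y-x x≤1) (term≤power n)) ⟩
      (1# - x ^ n) + x ^ n * (1# - x)
          ≈⟨ solve 2 (λ p x → (c1 :- p) :+ p :* (c1 :- x) := c1 :- x :* p) refl (x ^ n) x ⟩
      1# - x * x ^ n                                 ∎

  -- The preimage is the supremum s of all x with exp x ≤ y: 0 is one of them since 1 ≤ y, and y
  -- bounds them since 1 + x ≤ exp x. Were exp s different from y, s could be moved a little, up or
  -- down, without crossing y.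
  exp-surjective : ∀ {y} → 1# ≤ y → ∃ λ x → exp x ≈ y
  exp-surjective {y} 1≤y = s , ≤-antisym (≮⇒≥ ¬y<exp) (≮⇒≥ ¬exp<y)
    where
    0<y = <-≤-trans 0<1 1≤y
    sup = complete (λ x → exp x ≤ y) (0# , ≤-trans (≤-reflexive exp-0) 1≤y) (y , λ x h → ≮⇒≥ λ y<x →
      <⇒≱ (<-≤-trans (<-diff 0<1 (solve 1 (λ x → c1 := (c1 :+ x) :- x) refl x)) (1+x≤exp (<⇒≤ (<-trans 0<y y<x))))
          (≤-trans h (<⇒≤ y<x)))
    s = proj₁ sup
    -- With r = a / b and h = 1 - r, the bound exp h (1 - h) ≤ 1 says exp h * r ≤ 1. This stands in
    -- for the continuity of `exp`.
    shrink : ∀ {a b} → 0# < a → a < b → ∃ λ h → 0# < h × exp h * a ≤ b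
    shrink {a} {b} 0<a a<b = 1# - r , x<y⇒0<y-x r<1 , (begin
      exp (1# - r) * a                   ≈⟨ *-congˡ (/-*-cancel a 0<b) ⟨
      exp (1# - r) * (r * b)
          ≈⟨ solve 3 (λ e r b → e :* (r :* b) := e :* (c1 :- (c1 :- r)) :* b) refl (exp (1# - r)) r b ⟩
      exp (1# - r) * (1# - (1# - r)) * b ≤⟨ *-monoʳ-≤ b (<⇒≤ 0<b) (exp-*[1-x]≤1 (<⇒≤ (x<y⇒0<y-x r<1))
                                              (≤-diff (<⇒≤ (/-pos 0<a 0<b)) (solve 1 (λ r → r := c1 :- (c1 :- r)) refl r))) ⟩
      1# * b                             ≈⟨ *-identityˡ b ⟩
      b                                  ∎)
      where
      0<b = <-trans 0<a a<b
      r = a / b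
      r<1 : r < 1#
      r<1 = <⇒/< 0<b (<-respʳ-≈ (sym (*-identityˡ b)) a<b)
    ¬exp<y : ¬ exp s < y
    ¬exp<y lt = let (h , 0<h , le) = shrink (exp-pos s) lt in
      <⇒≱ (<-diff 0<h (solve 2 (λ s h → h := (h :+ s) :- s) refl s h))
          (proj₁ (proj₂ sup) (h + s) (≤-trans (≤-reflexive (exp-+ h s)) le))
    ¬y<exp : ¬ y < exp s
    ¬y<exp lt = let (h , 0<h , le) = shrink 0<y lt in
      <⇒≱ (<-diff 0<h (solve 2 (λ s h → h := s :- (s :- h)) refl s h))
          (proj₂ (proj₂ sup) (s - h) λ x exp-x≤y → exp-cancel-≤ (*-cancelʳ-≤ (exp h) (exp-pos h) (begin
            exp x * exp h        ≤⟨ *-monoʳ-≤ _ (<⇒≤ (exp-pos h)) exp-x≤y ⟩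
            y * exp h            ≈⟨ *-comm _ _ ⟩
            exp h * y            ≤⟨ le ⟩
            exp s                ≈⟨ exp-cong (solve 2 (λ s h → s := (s :- h) :+ h) refl s h) ⟩
            exp (s - h + h)      ≈⟨ exp-+ _ _ ⟩
            exp (s - h) * exp h  ∎)))

  -- What gives `ln`, `√` and `⌊_⌋` their meaning: once a solution is known to exist, the default
  -- value cannot occur.
  the-satisfies : {A : Set} {default : A} (P : A → Set) → ∃ P → P (the default P)
  the-satisfies P p with em {P = ∃ P}
  ... | yes (_ , q) = q
  ... | no ¬p = ⊥-elim (¬p p)

  exp-ln : ∀ {y} → 1# ≤ y → exp (ln y) ≈ y
  exp-ln {y} 1≤y = the-satisfies (λ x → exp x ≈ y) (exp-surjective 1≤y)

  ln-unique : ∀ {x y} → 1# ≤ y → exp x ≈ y → ln y ≈ x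
  ln-unique 1≤y eq = exp-injective (trans (exp-ln 1≤y) (sym eq))

  ln-1 : ln 1# ≈ 0#
  ln-1 = ln-unique ≤-refl exp-0

  ln-cong : ∀ {x y} → 1# ≤ x → x ≈ y → ln x ≈ ln y
  ln-cong 1≤x x≈y = ln-unique 1≤x (trans (exp-ln (≤-respʳ-≈ x≈y 1≤x)) (sym x≈y))

  ln-mono-≤ : ∀ {x y} → 1# ≤ x → x ≤ y → ln x ≤ ln y
  ln-mono-≤ 1≤x x≤y = exp-cancel-≤ (≤-respˡ-≈ (sym (exp-ln 1≤x)) (≤-respʳ-≈ (sym (exp-ln (≤-trans 1≤x x≤y))) x≤y))

  ln-nonNeg : ∀ {x} → 1# ≤ x → 0# ≤ ln x
  ln-nonNeg 1≤x = ≤-respˡ-≈ ln-1 (ln-mono-≤ ≤-refl 1≤x)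

  ln-pos : ∀ {x} → 1# < x → 0# < ln x
  ln-pos {x} (1≤x , 1≉x) = ln-nonNeg 1≤x , λ 0≈ln → 1≉x (trans (sym exp-0) (trans (exp-cong 0≈ln) (exp-ln 1≤x)))

  1+ln≤ : ∀ {x} → 1# ≤ x → 1# + ln x ≤ x
  1+ln≤ 1≤x = ≤-trans (1+x≤exp (ln-nonNeg 1≤x)) (≤-reflexive (exp-ln 1≤x))

  1≤* : ∀ {x y} → 1# ≤ x → 1# ≤ y → 1# ≤ x * y
  1≤* 1≤x 1≤y = ≤-respˡ-≈ (*-identityˡ 1#) (*-mono-≤ 0≤1 0≤1 1≤x 1≤y)

  ln-* : ∀ {x y} → 1# ≤ x → 1# ≤ y → ln (x * y) ≈ ln x + ln y
  ln-* 1≤x 1≤y = ln-unique (1≤* 1≤x 1≤y) (trans (exp-+ _ _) (*-cong (exp-ln 1≤x) (exp-ln 1≤y)))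

  exp-fromℕ-* : ∀ n x → exp (fromℕ n * x) ≈ exp x ^ n
  exp-fromℕ-* zero    x = trans (exp-cong (zeroˡ x)) exp-0
  exp-fromℕ-* (suc n) x = begin-equality
    exp ((1# + fromℕ n) * x)      ≈⟨ exp-cong (solve 2 (λ n x → (c1 :+ n) :* x := x :+ n :* x) refl (fromℕ n) x) ⟩
    exp (x + fromℕ n * x)         ≈⟨ exp-+ _ _ ⟩
    exp x * exp (fromℕ n * x)     ≈⟨ *-congˡ (exp-fromℕ-* n x) ⟩
    exp x * exp x ^ n             ∎

  1≤^ : ∀ {x} → 1# ≤ x → ∀ n → 1# ≤ x ^ n
  1≤^ 1≤x zero    = ≤-refl
  1≤^ 1≤x (suc n) = 1≤* 1≤x (1≤^ 1≤x n)

  exp-fromℕ-*-ln : ∀ {x} → 1# ≤ x → ∀ n → exp (fromℕ n * ln x) ≈ x ^ n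
  exp-fromℕ-*-ln 1≤x n = trans (exp-fromℕ-* n _) (^-congˡ n (exp-ln 1≤x))

  ln-^ : ∀ {x} → 1# ≤ x → ∀ n → ln (x ^ n) ≈ fromℕ n * ln x
  ln-^ 1≤x n = ln-unique (1≤^ 1≤x n) (exp-fromℕ-*-ln 1≤x n)

  -- The root is exp (ln y / 2), so no further supremum has to be taken.
  √-spec : ∀ {y} → 1# ≤ y → 0# ≤ √ y × √ y * √ y ≈ y
  √-spec {y} 1≤y = the-satisfies (λ x → 0# ≤ x × x * x ≈ y) (exp (half (ln y)) , <⇒≤ (exp-pos _) ,
    trans (sym (exp-+ _ _)) (trans (exp-cong (half-+ _)) (exp-ln 1≤y)))

  fromℤ-cancel : ∀ i j → fromℤ i < fromℤ j + 1# → i ℤ.≤ j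
  fromℤ-cancel (+ m) (+ n) h = ℤ.+≤+ (ℕ.s≤s⁻¹ (fromℕ-cancel-< (<-respʳ-≈ (+-comm _ 1#) h)))
  fromℤ-cancel (+ m) -[1+ n ] h = ⊥-elim (<⇒≱ h (≤-diff (+-nonNeg (0≤fromℕ m) (0≤fromℕ n))
    (solve 2 (λ m n → m :+ n := m :- (:- (c1 :+ n) :+ c1)) refl (fromℕ m) (fromℕ n))))
  fromℤ-cancel -[1+ m ] (+ n) h = ℤ.-≤+
  fromℤ-cancel -[1+ m ] -[1+ n ] h = ℤ.-≤- (ℕ.s≤s⁻¹ (fromℕ-cancel-< (<-diff (x<y⇒0<y-x h)
    (solve 2 (λ m n → (:- (c1 :+ n) :+ c1) :- (:- (c1 :+ m)) := (c1 :+ m) :- n) refl (fromℕ m) (fromℕ n)))))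

  ⌊⌋-unique : ∀ {x} z → fromℤ z ≤ x → x < fromℤ z + 1# → ⌊ x ⌋ ≡ z
  ⌊⌋-unique {x} z z≤x x<z+1 =
    ℤ.≤-antisym (fromℤ-cancel _ _ (≤-<-trans (proj₁ spec) x<z+1)) (fromℤ-cancel _ _ (≤-<-trans z≤x (proj₂ spec)))
    where
    spec : fromℤ ⌊ x ⌋ ≤ x × x < fromℤ ⌊ x ⌋ + 1#
    spec = the-satisfies (λ z → fromℤ z ≤ x × x < fromℤ z + 1#) (z , z≤x , x<z+1)

  ⌈⌉-unique : ∀ {x} n → fromℕ n < x → x ≤ fromℕ (suc n) → ⌈ x ⌉ ≡ + suc n
  ⌈⌉-unique {x} n n<x x≤n+1 = ≡.cong ℤ.-_ (⌊⌋-unique -[1+ n ] (neg-mono-≤ x≤n+1)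
    (<-diff (x<y⇒0<y-x n<x) (solve 2 (λ n x → x :- n := (:- (c1 :+ n) :+ c1) :- (:- x)) refl (fromℕ n) x)))

  1≤2 : 1# ≤ 2#
  1≤2 = ≤-respˡ-≈ (+-identityʳ 1#) (fromℕ-mono-≤ {1} {2} (ℕ.s≤s ℕ.z≤n))

  0<ln2 : 0# < ln 2#
  0<ln2 = ln-pos (<-respˡ-≈ (+-identityʳ 1#) (fromℕ-mono-< {1} {2} ℕ.≤-refl))

  0≤√2 : 0# ≤ √ 2#
  0≤√2 = proj₁ (√-spec 1≤2)

  1≤√2 : 1# ≤ √ 2#
  1≤√2 = square-cancel-≤ 0≤√2 (≤-respˡ-≈ (sym (*-identityˡ 1#)) (≤-trans 1≤2 (≤-reflexive (sym (proj₂ (√-spec 1≤2))))))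

  ln2≈ : ln 2# ≈ ln (√ 2#) + ln (√ 2#)
  ln2≈ = trans (ln-cong 1≤2 (sym (proj₂ (√-spec 1≤2)))) (ln-* 1≤√2 1≤√2)

  0<ln√2 : 0# < ln (√ 2#)
  0<ln√2 =
    *-cancelʳ-< 2# (<⇒≤ 0<2) (<-respˡ-≈ (sym (zeroˡ 2#)) (<-respʳ-≈ (trans ln2≈ (solve 1 (λ l → l :+ l := l :* c2) refl _)) 0<ln2))

  fromℕ-2^ : ∀ n → fromℕ (2 ℕ.^ n) ≈ exp (fromℕ n * ln 2#)
  fromℕ-2^ n = trans (fromℕ-^ 2 n) (sym (exp-fromℕ-*-ln 1≤2 n))

  0<2^ : ∀ n → 0# < fromℕ (2 ℕ.^ n)
  0<2^ n = <-respʳ-≈ (sym (fromℕ-2^ n)) (exp-pos _)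

  ⁻¹-unique : ∀ {x y} → 0# < y → x * y ≈ 1# → x ≈ y ⁻¹
  ⁻¹-unique {x} {y} 0<y eq = *-cancelʳ-≈ y 0<y (trans eq (trans (sym (*-inverseʳ 0<y)) (*-comm _ _)))

  -- In terms of α² the exponent is ⌊log₂ α²⌋.
  f-spec : ∀ {α} → 1# ≤ α → ∃ λ n → fromℕ (2 ℕ.^ n) ≤ α * α × α * α < fromℕ (2 ℕ.^ suc n) × f α ≈ 1# - fromℕ (2 ℕ.^ suc n) ⁻¹
  f-spec {α} 1≤α = n , lower , upper , f≈
    where
    L = ln (√ 2#)
    0≤log : 0# ≤ ln α / L
    0≤log = *-nonNeg (ln-nonNeg 1≤α) (<⇒≤ (⁻¹-pos 0<ln√2))
    floor = natFloor 0≤log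
    n = proj₁ floor
    n≤log = proj₁ (proj₂ floor)
    log<n+1 = proj₂ (proj₂ floor)
    α²≈ : exp (ln α + ln α) ≈ α * α
    α²≈ = trans (exp-+ _ _) (*-cong (exp-ln 1≤α) (exp-ln 1≤α))
    double : ∀ k → fromℕ k * L + fromℕ k * L ≈ fromℕ k * ln 2#
    double k = trans (sym (distribˡ _ _ _)) (*-congˡ (sym ln2≈))
    lower : fromℕ (2 ℕ.^ n) ≤ α * α
    lower = begin
      fromℕ (2 ℕ.^ n)               ≈⟨ fromℕ-2^ n ⟩
      exp (fromℕ n * ln 2#)         ≈⟨ exp-cong (double n) ⟨
      exp (fromℕ n * L + fromℕ n * L) ≤⟨ exp-mono-≤ (+-mono-≤ h h) ⟩
      exp (ln α + ln α)             ≈⟨ α²≈ ⟩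
      α * α                         ∎
      where h = ≤-trans (*-monoʳ-≤ L (<⇒≤ 0<ln√2) n≤log) (≤-reflexive (/-*-cancel (ln α) 0<ln√2))
    upper : α * α < fromℕ (2 ℕ.^ suc n)
    upper = begin-strict
      α * α                         ≈⟨ α²≈ ⟨
      exp (ln α + ln α)
          <⟨ exp-mono-< (<-≤-trans (<-diff (x<y⇒0<y-x h) (solve 2 (λ a b → b :- a := (b :+ a) :- (a :+ a)) refl (ln α) (fromℕ (suc n) * L))) (+-mono-≤ ≤-refl (<⇒≤ h))) ⟩
      exp (fromℕ (suc n) * L + fromℕ (suc n) * L) ≈⟨ exp-cong (double (suc n)) ⟩
      exp (fromℕ (suc n) * ln 2#)   ≈⟨ fromℕ-2^ (suc n) ⟨
      fromℕ (2 ℕ.^ suc n)           ∎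
      where
      h : ln α < fromℕ (suc n) * L
      h = ≤-<-trans (≤-reflexive (sym (/-*-cancel (ln α) 0<ln√2))) (*-monoʳ-< L 0<ln√2 log<n+1)
    ⌊log⌋ : ⌊ log (√ 2#) α ⌋ ≡ + n
    ⌊log⌋ = ⌊⌋-unique (+ n) n≤log (<-respʳ-≈ (+-comm 1# _) log<n+1)
    f≈ : f α ≈ 1# - fromℕ (2 ℕ.^ suc n) ⁻¹
    f≈ =
      trans (reflexive (≡.cong (λ z → 1# - fromℕ 2 ^ʳ (- fromℤ z - 1#)) ⌊log⌋)) (+-congˡ (-‿cong (⁻¹-unique (0<2^ (suc n)) (begin-equality
      exp ((- fromℕ n - 1#) * ln 2#) * fromℕ (2 ℕ.^ suc n)             ≈⟨ *-congˡ (fromℕ-2^ (suc n)) ⟩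
      exp ((- fromℕ n - 1#) * ln 2#) * exp (fromℕ (suc n) * ln 2#)     ≈⟨ exp-+ _ _ ⟨
      exp ((- fromℕ n - 1#) * ln 2# + fromℕ (suc n) * ln 2#)
          ≈⟨ exp-cong (solve 2 (λ n l → (:- n :- c1) :* l :+ (c1 :+ n) :* l := c0) refl (fromℕ n) (ln 2#)) ⟩
      exp 0#                                                           ≈⟨ exp-0 ⟩
      1#                                                               ∎))))

-- The behaviour of f, and the choice of m, δ and Δ

module ParameterChoice (em : ExcludedMiddle 0ℓ) (R : CompleteOrderedField) where

  open OrderedFieldSolver em R
  open OrderedField em R
  open Limits em R
  open ExponentialSeries em R
  open ExpLog em R

  open ≤-Reasoning
  open Algebra.Properties.CommutativeSemiring.Exp (CommutativeRing.commutativeSemiring commutativeRing) using (^-distrib-*)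

  1≤fromℕ : ∀ {n} → 1 ℕ.≤ n → 1# ≤ fromℕ n
  1≤fromℕ 1≤n = ≤-respˡ-≈ (+-identityʳ 1#) (fromℕ-mono-≤ 1≤n)

  ⁻¹-anti-≤ : ∀ {x y} → 0# < x → x ≤ y → y ⁻¹ ≤ x ⁻¹
  ⁻¹-anti-≤ {x} {y} 0<x x≤y = *-cancelʳ-≤ y 0<y (begin
    y ⁻¹ * y      ≈⟨ trans (*-comm _ _) (*-inverseʳ 0<y) ⟩
    1#            ≈⟨ trans (*-comm _ _) (*-inverseʳ 0<x) ⟨
    x ⁻¹ * x      ≤⟨ *-monoˡ-≤ _ (<⇒≤ (⁻¹-pos 0<x)) x≤y ⟩
    x ⁻¹ * y      ∎)
    where 0<y = <-≤-trans 0<x x≤y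

  2^-cancel-≤ : ∀ m n → fromℕ (2 ℕ.^ m) < fromℕ (2 ℕ.^ suc n) → m ℕ.≤ n
  2^-cancel-≤ m n h = ℕ.≮⇒≥ λ n<m → <⇒≱ h (fromℕ-mono-≤ (ℕ.^-monoʳ-≤ 2 n<m))

  f-nonNeg : ∀ α → 1# ≤ α → 0# ≤ f α
  f-nonNeg α 1≤α = let (n , _ , _ , f≈) = f-spec 1≤α in
    ≤-respʳ-≈ (sym f≈) (x≤y⇒0≤y-x (*-cancelʳ-≤ _ (0<2^ (suc n)) (begin
      fromℕ (2 ℕ.^ suc n) ⁻¹ * fromℕ (2 ℕ.^ suc n)   ≈⟨ trans (*-comm _ _) (*-inverseʳ (0<2^ (suc n))) ⟩
      1#                                             ≤⟨ 1≤fromℕ (ℕ.m^n>0 2 (suc n)) ⟩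
      fromℕ (2 ℕ.^ suc n)                            ≈⟨ *-identityˡ _ ⟨
      1# * fromℕ (2 ℕ.^ suc n)                       ∎)))

  -- For the exponents m of α and n of β, 2 ^ m ≤ α² ≤ β² < 2 ^ (n + 1) forces m ≤ n.
  f-mono : ∀ α β → 1# ≤ α → α ≤ β → f α ≤ f β
  f-mono α β 1≤α α≤β =
    let 1≤β = ≤-trans 1≤α α≤β
        0≤α = ≤-trans 0≤1 1≤α
        (m , 2^m≤α² , _ , fα≈) = f-spec 1≤α
        (n , _ , β²<2^n+1 , fβ≈) = f-spec 1≤β
        m≤n = 2^-cancel-≤ m n (≤-<-trans (≤-trans 2^m≤α² (*-mono-≤ 0≤α 0≤α α≤β α≤β)) β²<2^n+1)
    in ≤-respˡ-≈ (sym fα≈) (≤-respʳ-≈ (sym fβ≈) (+-mono-≤ ≤-refl (neg-mono-≤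
         (⁻¹-anti-≤ (0<2^ (suc m)) (fromℕ-mono-≤ (ℕ.^-monoʳ-≤ 2 (ℕ.s≤s m≤n)))))))

  f-limit : ∀ ε → 0# < ε → ∃ λ A → ∀ α → 1# ≤ α → A ≤ α → ∣ f α - 1# ∣ ≤ ε
  -- The crude chain 1/ε ≤ α ≤ α² < T suffices, the distance from `f α` to 1 being 1/T.
  f-limit ε 0<ε = ε ⁻¹ , λ α 1≤α ε⁻¹≤α →
    let (n , _ , α²< , f≈) = f-spec 1≤α
        T = fromℕ (2 ℕ.^ suc n)
        0<T = 0<2^ (suc n)
        ε⁻¹≤T : ε ⁻¹ ≤ T
        ε⁻¹≤T = begin
          ε ⁻¹      ≤⟨ ε⁻¹≤α ⟩
          α         ≈⟨ *-identityˡ α ⟨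
          1# * α    ≤⟨ *-monoʳ-≤ α (≤-trans 0≤1 1≤α) 1≤α ⟩
          α * α     ≤⟨ <⇒≤ α²< ⟩
          T         ∎
        T⁻¹≤ε : T ⁻¹ ≤ ε
        T⁻¹≤ε = *-cancelʳ-≤ T 0<T (begin
          T ⁻¹ * T  ≈⟨ trans (*-comm _ _) (*-inverseʳ 0<T) ⟩
          1#        ≈⟨ *-inverseʳ 0<ε ⟨
          ε * ε ⁻¹  ≤⟨ *-monoˡ-≤ ε (<⇒≤ 0<ε) ε⁻¹≤T ⟩
          ε * T     ∎)
        eq : - (f α - 1#) ≈ T ⁻¹
        eq = trans (-‿cong (+-congʳ f≈)) (solve 1 (λ t → :- ((c1 :- t) :- c1) := t) refl (T ⁻¹))
    in ∣∣-intro ( ≤-diff (+-nonNeg (<⇒≤ 0<ε) (<⇒≤ (⁻¹-pos 0<T))) (+-congˡ (sym eq))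
                , ≤-respˡ-≈ (sym eq) T⁻¹≤ε)

  -- At 2√2 the square is 8 = 2 ^ 3, exactly where the exponent jumps to 3. The value 15/16 is
  -- therefore taken from 2√2 upwards, which is why o is nonnegative, and as long as α stays below
  -- 4, which is why o is kept under half of the gap 4 - 2√2.
  f-15/16 : ∀ (o : ℕ → ℝ) → (∀ n → 0# ≤ o n) → o ⟶ 0# →
    ∃ λ N → ∀ n → N ℕ.≤ n → f (2# * √ 2# + o n) ≈ fromℕ 15 / fromℕ 16
  f-15/16 o 0≤o o⟶0 =
    proj₁ near , λ n N≤n → at (o n) (0≤o n) (≤-respˡ-≈ (solve 1 (λ x → x :- c0 := x) refl (o n)) (proj₁ (proj₂ near n N≤n)))
    where
    s = √ 2#
    b = 2# * s
    b²≈8 : b * b ≈ 2# * 2# * 2#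
    b²≈8 = trans (solve 1 (λ s → (c2 :* s) :* (c2 :* s) := c2 :* c2 :* (s :* s)) refl s) (*-congˡ (proj₂ (√-spec 1≤2)))
    0≤b = *-nonNeg (<⇒≤ 0<2) 0≤√2
    0≤4 = *-nonNeg (<⇒≤ 0<2) (<⇒≤ 0<2)
    b<4 : b < 2# * 2#
    b<4 = square-cancel-< 0≤4 (<-respˡ-≈ (sym b²≈8) (<-diff (*-pos (*-pos 0<2 0<2) 0<2)
      (solve 0 (c2 :* c2 :* c2 := (c2 :* c2) :* (c2 :* c2) :- c2 :* c2 :* c2) refl)))
    ε = half (2# * 2# - b)
    0<ε = half-pos (x<y⇒0<y-x b<4)
    near = close o⟶0 ε 0<ε
    at : ∀ x → 0# ≤ x → x ≤ ε → f (b + x) ≈ fromℕ 15 / fromℕ 16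
    at x 0≤x x≤ε = result
      where
      b≤b+x : b ≤ b + x
      b≤b+x = ≤-diff 0≤x (solve 2 (λ b x → x := (b :+ x) :- b) refl b x)
      1≤b+x : 1# ≤ b + x
      1≤b+x = ≤-trans (1≤* 1≤2 1≤√2) b≤b+x
      b+x<4 : b + x < 2# * 2#
      b+x<4 = <-diff (+-pos 0<ε (x≤y⇒0≤y-x x≤ε)) (begin-equality
        ε + (ε - x)        ≈⟨ solve 2 (λ e x → e :+ (e :- x) := (e :+ e) :- x) refl ε x ⟩
        (ε + ε) - x        ≈⟨ +-congʳ (half-+ _) ⟩
        (2# * 2# - b) - x  ≈⟨ solve 2 (λ b x → (c2 :* c2 :- b) :- x := c2 :* c2 :- (b :+ x)) refl b x ⟩
        2# * 2# - (b + x)  ∎)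
      0≤b+x = ≤-trans 0≤b b≤b+x
      result : f (b + x) ≈ fromℕ 15 / fromℕ 16
      result = finish (f-spec 1≤b+x)
        where
        finish : (∃ λ n → fromℕ (2 ℕ.^ n) ≤ (b + x) * (b + x) × (b + x) * (b + x) < fromℕ (2 ℕ.^ suc n) × f (b + x) ≈ 1# - fromℕ (2 ℕ.^ suc n) ⁻¹) →
                 f (b + x) ≈ fromℕ 15 / fromℕ 16
        finish (n , lower , upper , f≈) = trans f≈ (≡.subst (λ n → 1# - fromℕ (2 ℕ.^ suc n) ⁻¹ ≈ fromℕ 15 / fromℕ 16) 3≡n
          (begin-equality
            1# - fromℕ 16 ⁻¹                          ≈⟨ +-congʳ (*-inverseʳ (fromℕ-pos 16)) ⟨
            fromℕ 16 * fromℕ 16 ⁻¹ - fromℕ 16 ⁻¹      ≈⟨ +-congʳ (*-congʳ (fromℕ-+ 1 15)) ⟩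
            (fromℕ 1 + fromℕ 15) * fromℕ 16 ⁻¹ - fromℕ 16 ⁻¹
                ≈⟨ solve 2 (λ a i → ((c1 :+ c0) :+ a) :* i :- i := a :* i) refl (fromℕ 15) (fromℕ 16 ⁻¹) ⟩
            fromℕ 15 / fromℕ 16                       ∎))
          where
          8≈ : fromℕ (2 ℕ.^ 3) ≈ 2# * 2# * 2#
          8≈ = trans (fromℕ-* 4 2) (*-congʳ (fromℕ-* 2 2))
          16≈ : fromℕ (2 ℕ.^ 4) ≈ (2# * 2#) * (2# * 2#)
          16≈ = trans (fromℕ-* 4 4) (*-cong (fromℕ-* 2 2) (fromℕ-* 2 2))
          3≤n : 3 ℕ.≤ n
          3≤n = 2^-cancel-≤ 3 n (≤-<-trans (≤-trans (≤-reflexive (trans 8≈ (sym b²≈8))) (*-mono-≤ 0≤b 0≤b b≤b+x b≤b+x)) upper)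
          n≤3 : n ℕ.≤ 3
          n≤3 = 2^-cancel-≤ n 3 (≤-<-trans lower (<-respʳ-≈ (sym 16≈) (≤-<-trans (*-monoˡ-≤ (b + x) 0≤b+x (<⇒≤ b+x<4))
                  (*-monoʳ-< (2# * 2#) (*-pos 0<2 0<2) b+x<4))))
          3≡n : 3 ≡ n
          3≡n = ℕ.≤-antisym 3≤n n≤3

  -- With K = k + 1 the exponent 1 - 1/K sends m ^ K to m ^ (K - 1): for a perfect K-th power ℓ the
  -- required conflict degree is a natural number.
  m^k≈ : ∀ {α k} → f α ≈ 1# - fromℕ (suc k) ⁻¹ → ∀ m → 1 ℕ.≤ m → fromℕ (m ℕ.^ k) ≈ fromℕ (m ℕ.^ suc k) ^ʳ f α
  m^k≈ {α} {k} f≈ m 1≤m = sym (begin-equality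
    exp (f α * ln (fromℕ (m ℕ.^ suc k)))
        ≈⟨ exp-cong (*-cong f≈ (trans (ln-cong (1≤fromℕ (ℕ.m^n>0 m {{ℕ.>-nonZero 1≤m}} (suc k))) (fromℕ-^ m (suc k))) (ln-^ 1≤mʳ (suc k)))) ⟩
    exp ((1# - i) * (K * l))
        ≈⟨ exp-cong (solve 3 (λ i K l → (c1 :- i) :* (K :* l) := K :* l :- (K :* i) :* l) refl i K l) ⟩
    exp (K * l - (K * i) * l)                 ≈⟨ exp-cong (+-congˡ (-‿cong (*-congʳ (*-inverseʳ (fromℕ-pos (suc k)))))) ⟩
    exp (K * l - 1# * l)                      ≈⟨ exp-cong (solve 2 (λ k l → (c1 :+ k) :* l :- c1 :* l := k :* l) refl (fromℕ k) l) ⟩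
    exp (fromℕ k * l)                         ≈⟨ exp-fromℕ-*-ln 1≤mʳ k ⟩
    fromℕ m ^ k                               ≈⟨ fromℕ-^ m k ⟨
    fromℕ (m ℕ.^ k)                           ∎)
    where
    1≤mʳ = 1≤fromℕ 1≤m
    K = fromℕ (suc k)
    i = K ⁻¹
    l = ln (fromℕ m)

  ^-nonNeg : ∀ {x} → 0# ≤ x → ∀ n → 0# ≤ x ^ n
  ^-nonNeg 0≤x zero    = 0≤1
  ^-nonNeg 0≤x (suc n) = *-nonNeg 0≤x (^-nonNeg 0≤x n)

  ^-pos : ∀ {x} → 0# < x → ∀ n → 0# < x ^ n
  ^-pos 0<x zero    = 0<1
  ^-pos 0<x (suc n) = *-pos 0<x (^-pos 0<x n)

  ^-monoˡ-≤ : ∀ {x y} → 0# ≤ x → x ≤ y → ∀ n → x ^ n ≤ y ^ n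
  ^-monoˡ-≤ 0≤x x≤y zero    = ≤-refl
  ^-monoˡ-≤ 0≤x x≤y (suc n) = *-mono-≤ 0≤x (^-nonNeg 0≤x n) x≤y (^-monoˡ-≤ 0≤x x≤y n)

  -- (1 - 1/M) ^ δ ≤ exp (- δ/M) < 1/M
  power-decay : ∀ M δ → 2 ℕ.≤ M → fromℕ M * ln (fromℕ M) < fromℕ δ → M ℕ.* (M ∸ 1) ℕ.^ δ ℕ.< M ℕ.^ δ
  power-decay M δ 2≤M h = fromℕ-cancel-< (begin-strict
    fromℕ (M ℕ.* (M ∸ 1) ℕ.^ δ)      ≈⟨ trans (fromℕ-* M _) (*-congˡ (fromℕ-^ (M ∸ 1) δ)) ⟩
    Mʳ * M-1 ^ δ                     <⟨ *-monoʳ-< _ (^-pos 0<M-1 δ) M<exp ⟩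
    exp (fromℕ δ * t) * M-1 ^ δ      ≈⟨ *-congʳ (exp-fromℕ-* δ t) ⟩
    exp t ^ δ * M-1 ^ δ              ≈⟨ ^-distrib-* (exp t) M-1 δ ⟨
    (exp t * M-1) ^ δ                ≤⟨ ^-monoˡ-≤ (*-nonNeg (<⇒≤ (exp-pos t)) (<⇒≤ 0<M-1)) step δ ⟩
    Mʳ ^ δ                           ≈⟨ fromℕ-^ M δ ⟨
    fromℕ (M ℕ.^ δ)                  ∎)
    where
    1≤M = ℕ.≤-trans (ℕ.s≤s ℕ.z≤n) 2≤M
    Mʳ = fromℕ M
    M-1 = fromℕ (M ∸ 1)
    0<M : 0# < Mʳ
    0<M = fromℕ-mono-< 1≤M
    0<M-1 : 0# < M-1
    0<M-1 = fromℕ-mono-< (ℕ.∸-monoˡ-≤ 1 2≤M)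
    t = Mʳ ⁻¹
    M-1≈ : M-1 ≈ (1# - t) * Mʳ
    M-1≈ = begin-equality
      M-1                     ≈⟨ solve 1 (λ x → x := ((c1 :+ c0) :+ x) :- c1) refl M-1 ⟩
      (fromℕ 1 + M-1) - 1#    ≈⟨ +-cong (fromℕ-∸ 1≤M) (-‿cong (sym (*-inverseʳ 0<M))) ⟩
      Mʳ - Mʳ * t             ≈⟨ solve 2 (λ M t → M :- M :* t := (c1 :- t) :* M) refl Mʳ t ⟩
      (1# - t) * Mʳ           ∎
    t≤1 : t ≤ 1#
    t≤1 = *-cancelʳ-≤ Mʳ 0<M (begin
      t * Mʳ    ≈⟨ trans (*-comm _ _) (*-inverseʳ 0<M) ⟩
      1#        ≤⟨ 1≤fromℕ 1≤M ⟩
      Mʳ        ≈⟨ *-identityˡ Mʳ ⟨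
      1# * Mʳ   ∎)
    step : exp t * M-1 ≤ Mʳ
    step = begin
      exp t * M-1               ≈⟨ *-congˡ M-1≈ ⟩
      exp t * ((1# - t) * Mʳ)   ≈⟨ *-assoc _ _ _ ⟨
      exp t * (1# - t) * Mʳ     ≤⟨ *-monoʳ-≤ Mʳ (<⇒≤ 0<M) (exp-*[1-x]≤1 (<⇒≤ (⁻¹-pos 0<M)) t≤1) ⟩
      1# * Mʳ                   ≈⟨ *-identityˡ Mʳ ⟩
      Mʳ                        ∎
    M<exp : Mʳ < exp (fromℕ δ * t)
    M<exp = begin-strict
      Mʳ                    ≈⟨ exp-ln (1≤fromℕ 1≤M) ⟨
      exp (ln Mʳ)           <⟨ exp-mono-< (<⇒</ 0<M (≤-<-trans (≤-reflexive (*-comm _ _)) h)) ⟩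
      exp (fromℕ δ * t)     ∎

  -- For the rounding it is enough that P switches to its negation between k and k + 1, so the
  -- monotonicity of N / ln N never enters.
  lastBefore : (P : ℕ → Set) → ∀ {m n} → m ℕ.≤ n → P m → ¬ P n → ∃ λ k → m ℕ.≤ k × P k × ¬ P (suc k)
  lastBefore P {m} m≤n Pm ¬Pn = go (ℕ.≤⇒≤′ m≤n) ¬Pn
    where
    go : ∀ {n} → m ℕ.≤′ n → ¬ P n → ∃ λ k → m ℕ.≤ k × P k × ¬ P (suc k)
    go ℕ.≤′-refl ¬Pn = ⊥-elim (¬Pn Pm)
    go (ℕ.≤′-step {n} p) ¬Pn with em {P = P n}
    ... | yes Pn = n , ℕ.≤′⇒≤ p , Pn , ¬Pn
    ... | no ¬P  = go p ¬P

  -- ℓ = m ^ suc k and D = m ^ k; δ bounds the degrees before the edges are multiplied.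
  record Parameters (α : ℝ) : Set where
    field
      m k δ Δ : ℕ
      2≤m     : 2 ℕ.≤ m
      1≤δ     : 1 ℕ.≤ δ
      decay   : m ℕ.* m ℕ.* (m ℕ.* m ∸ 1) ℕ.^ δ ℕ.< (m ℕ.* m) ℕ.^ δ
      δD²≤Δ   : δ ℕ.* (m ℕ.^ k ℕ.* m ℕ.^ k) ℕ.≤ Δ
      2≤Δ     : 2 ℕ.≤ Δ
      ℓ≡      : + (m ℕ.^ suc k) ≡ ⌈ α * √ (fromℕ Δ / ln (fromℕ Δ)) ⌉
      D≈      : fromℕ (m ℕ.^ k) ≈ fromℕ (m ℕ.^ suc k) ^ʳ f α

  module _ {α : ℝ} (1≤α : 1# ≤ α) where
    private
      α² = α * α
      0≤α = ≤-trans 0≤1 1≤α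
      1≤α² = 1≤* 1≤α 1≤α

    -- Δ is the largest one for which the ceiling is at most suc ℓ′, and increasing Δ by 1 barely changes its argument.
    ⌈⌉-at-threshold : ∀ ℓ′ Δ → 2 ℕ.≤ Δ → 1# ≤ ln (fromℕ Δ) → α² ≤ fromℕ (suc ℓ′) →
      α² * fromℕ Δ ≤ fromℕ (suc ℓ′) * fromℕ (suc ℓ′) * ln (fromℕ Δ) →
      ¬ α² * fromℕ (suc Δ) ≤ fromℕ (suc ℓ′) * fromℕ (suc ℓ′) * ln (fromℕ (suc Δ)) →
      ⌈ α * √ (fromℕ Δ / ln (fromℕ Δ)) ⌉ ≡ + suc ℓ′
    ⌈⌉-at-threshold ℓ′ Δ 2≤Δ 1≤lnΔ α²≤ℓ below above = ⌈⌉-unique ℓ′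
        (square-cancel-< 0≤x (<-respʳ-≈ (sym x²≈) (*-cancelʳ-< lΔ (<⇒≤ 0<lΔ) (<-respʳ-≈ (sym y*lΔ) lower))))
        (square-cancel-≤ (0≤fromℕ (suc ℓ′)) (≤-respˡ-≈ (sym x²≈) (*-cancelʳ-≤ lΔ 0<lΔ (≤-respˡ-≈ (sym y*lΔ) below))))
      where
      Δʳ = fromℕ Δ
      L′ = fromℕ ℓ′
      L = fromℕ (suc ℓ′)
      lΔ = ln Δʳ
      1≤Δʳ = 1≤fromℕ (ℕ.≤-trans (ℕ.s≤s ℕ.z≤n) 2≤Δ)
      0<lΔ = <-≤-trans 0<1 1≤lnΔ
      q = Δʳ / lΔ
      1≤q : 1# ≤ q
      1≤q = ≤⇒≤/ 0<lΔ (begin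
        1# * lΔ   ≈⟨ *-identityˡ lΔ ⟩
        lΔ        ≤⟨ ≤-diff 0≤1 (solve 1 (λ l → c1 := (c1 :+ l) :- l) refl lΔ) ⟩
        1# + lΔ   ≤⟨ 1+ln≤ 1≤Δʳ ⟩
        Δʳ        ∎)
      x = α * √ q
      0≤x : 0# ≤ x
      0≤x = *-nonNeg 0≤α (proj₁ (√-spec 1≤q))
      x²≈ : x * x ≈ α² * q
      x²≈ = trans (solve 2 (λ a s → (a :* s) :* (a :* s) := (a :* a) :* (s :* s)) refl α (√ q)) (*-congˡ (proj₂ (√-spec 1≤q)))
      y*lΔ : α² * q * lΔ ≈ α² * Δʳ
      y*lΔ = trans (*-assoc _ _ _) (*-congˡ (/-*-cancel Δʳ 0<lΔ))
      -- Passing from Δ to Δ + 1 adds `α²` to α² Δ, and the two squares ℓ² and (ℓ - 1)², times ln Δ,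
      -- differ by `(L′ + L) * lΔ`.
      α²≤ : α² ≤ (L′ + L) * lΔ
      α²≤ = begin
        α²             ≤⟨ α²≤ℓ ⟩
        L              ≤⟨ ≤-diff (0≤fromℕ ℓ′) (solve 2 (λ a b → a := (a :+ b) :- b) refl L′ L) ⟩
        L′ + L         ≈⟨ *-identityʳ _ ⟨
        (L′ + L) * 1#  ≤⟨ *-monoˡ-≤ _ (+-nonNeg (0≤fromℕ ℓ′) (0≤fromℕ (suc ℓ′))) 1≤lnΔ ⟩
        (L′ + L) * lΔ  ∎
      above′ : L * L * lΔ < α² * fromℕ (suc Δ)
      above′ =
        ≤-<-trans (*-monoˡ-≤ _ (*-nonNeg (0≤fromℕ (suc ℓ′)) (0≤fromℕ (suc ℓ′))) (ln-mono-≤ 1≤Δʳ (<⇒≤ (fromℕ-step Δ)))) (≰⇒> above)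
      lower : L′ * L′ * lΔ < α² * Δʳ
      lower = <-diff (+-pos (x<y⇒0<y-x above′) (x≤y⇒0≤y-x α²≤))
        (solve 4 (λ L′ l a D → (a :* (c1 :+ D) :- (c1 :+ L′) :* (c1 :+ L′) :* l) :+ ((L′ :+ (c1 :+ L′)) :* l :- a) := a :* D :- L′ :* L′ :* l)
          refl L′ lΔ α² Δʳ)

    -- A square N = B * B makes the growth of ln elementary: ℓ² ln N = 2 ℓ² ln B ≤ 2 ℓ² B < B² ≤ α²
    -- N once B > 2 ℓ².
    eventually-above : ∀ ℓ N₀ → ∃ λ N → N₀ ℕ.≤ N × ¬ α² * fromℕ N ≤ fromℕ ℓ * fromℕ ℓ * ln (fromℕ N)
    eventually-above ℓ N₀ = at (suc (2 ℕ.* (ℓ ℕ.* ℓ) ℕ.+ N₀)) (ℕ.s≤s (ℕ.m≤m+n _ N₀)) (ℕ.m≤n⇒m≤1+n (ℕ.m≤n+m N₀ _))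
      where
      ℓʳ = fromℕ ℓ
      at : ∀ B → 2 ℕ.* (ℓ ℕ.* ℓ) ℕ.< B → N₀ ℕ.≤ B → ∃ λ N → N₀ ℕ.≤ N × ¬ α² * fromℕ N ≤ ℓʳ * ℓʳ * ln (fromℕ N)
      at B 2ℓ²<B N₀≤B = B ℕ.* B , ℕ.≤-trans N₀≤B (ℕ.m≤m*n B B {{ℕ.>-nonZero 1≤B}}) , <⇒≱ (begin-strict
          ℓʳ * ℓʳ * ln (fromℕ (B ℕ.* B))
              ≈⟨ *-congˡ (trans (ln-cong (≤-respʳ-≈ (sym B²≈) (1≤* 1≤Bʳ 1≤Bʳ)) B²≈) (ln-* 1≤Bʳ 1≤Bʳ)) ⟩
          ℓʳ * ℓʳ * (ln Bʳ + ln Bʳ)         ≤⟨ *-monoˡ-≤ _ (*-nonNeg (0≤fromℕ ℓ) (0≤fromℕ ℓ)) (+-mono-≤ lnB≤B lnB≤B) ⟩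
          ℓʳ * ℓʳ * (Bʳ + Bʳ)               ≈⟨ solve 2 (λ L B → L :* L :* (B :+ B) := c2 :* (L :* L) :* B) refl ℓʳ Bʳ ⟩
          2# * (ℓʳ * ℓʳ) * Bʳ               ≈⟨ *-congʳ (trans (fromℕ-* 2 (ℓ ℕ.* ℓ)) (*-congˡ (fromℕ-* ℓ ℓ))) ⟨
          fromℕ (2 ℕ.* (ℓ ℕ.* ℓ)) * Bʳ      <⟨ *-monoʳ-< Bʳ (<-≤-trans 0<1 1≤Bʳ) (fromℕ-mono-< 2ℓ²<B) ⟩
          Bʳ * Bʳ                           ≈⟨ *-identityˡ _ ⟨
          1# * (Bʳ * Bʳ)                    ≤⟨ *-mono-≤ 0≤1 (*-nonNeg (0≤fromℕ B) (0≤fromℕ B)) 1≤α² (≤-reflexive (sym B²≈)) ⟩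
          α² * fromℕ (B ℕ.* B)              ∎)
        where
        Bʳ = fromℕ B
        1≤B : 1 ℕ.≤ B
        1≤B = ℕ.≤-trans (ℕ.s≤s ℕ.z≤n) 2ℓ²<B
        1≤Bʳ : 1# ≤ Bʳ
        1≤Bʳ = 1≤fromℕ 1≤B
        B²≈ : fromℕ (B ℕ.* B) ≈ Bʳ * Bʳ
        B²≈ = fromℕ-* B B
        lnB≤B : ln Bʳ ≤ Bʳ
        lnB≤B = ≤-trans (≤-diff 0≤1 (solve 1 (λ l → c1 := (c1 :+ l) :- l) refl _)) (1+ln≤ 1≤Bʳ)

    -- The three demands on the size of m: `e≤m` gives ln m ≥ 1, `α²≤m` gives the bound α² ≤ ℓ under
    -- which the ceiling is controlled, and `α²≤mε` pays for rounding δ up.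
    module _ (k m : ℕ) (α²<K : α² < fromℕ (suc k)) (e≤m : exp 1# ≤ fromℕ m) (α²≤m : α² ≤ fromℕ m)
             (α²≤mε : α² ≤ fromℕ m * (fromℕ (suc k) - α²)) where
      private
        K = fromℕ (suc k)
        ε = K - α²
        0<ε = x<y⇒0<y-x α²<K
        mʳ = fromℕ m
        2≤m : 2 ℕ.≤ m
        2≤m = fromℕ-cancel-≤ (≤-trans (≤-respˡ-≈ (+-congˡ (sym (+-identityʳ 1#))) (1+x≤exp 0≤1)) e≤m)
        1≤m = ℕ.≤-trans (ℕ.s≤s ℕ.z≤n) 2≤m
        instance m≢0 : ℕ.NonZero m
                 m≢0 = ℕ.>-nonZero 1≤m
        1≤mʳ = 1≤fromℕ 1≤m
        l = ln mʳ
        1≤l : 1# ≤ l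
        1≤l = exp-cancel-≤ (≤-respʳ-≈ (sym (exp-ln 1≤mʳ)) e≤m)
        0≤l = ≤-trans 0≤1 1≤l
        M = m ℕ.* m
        Mʳ = fromℕ M
        M≈ : Mʳ ≈ mʳ * mʳ
        M≈ = fromℕ-* m m
        1≤M : 1 ℕ.≤ M
        1≤M = ℕ.*-mono-≤ 1≤m 1≤m
        m≤M : m ℕ.≤ M
        m≤M = ℕ.m≤m*n m m
        2≤M : 2 ℕ.≤ M
        2≤M = ℕ.≤-trans 2≤m m≤M
        lnM≈ : ln Mʳ ≈ l + l
        lnM≈ = trans (ln-cong (1≤fromℕ 1≤M) M≈) (ln-* 1≤mʳ 1≤mʳ)
        1≤lnM : 1# ≤ ln Mʳ
        1≤lnM =
          ≤-respʳ-≈ (sym lnM≈) (≤-diff (+-nonNeg (x≤y⇒0≤y-x 1≤l) 0≤l) (solve 1 (λ l → (l :- c1) :+ l := (l :+ l) :- c1) refl l))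

      -- `δ₀` is the floor of M ln M for M = m², so that δ = `suc δ₀` is the least degree to which
      -- `power-decay` applies.
      module _ (δ₀ : ℕ) (δ₀≤ : fromℕ δ₀ ≤ fromℕ (m ℕ.* m) * ln (fromℕ (m ℕ.* m)))
               (<δ : fromℕ (m ℕ.* m) * ln (fromℕ (m ℕ.* m)) < fromℕ (suc δ₀)) where
       private
        δ = suc δ₀
        δʳ = fromℕ δ
        M≤δ : M ℕ.≤ δ
        M≤δ = fromℕ-cancel-≤ (≤-trans (≤-respˡ-≈ (*-identityʳ _) (*-monoˡ-≤ Mʳ (0≤fromℕ M) 1≤lnM)) (<⇒≤ <δ))
        D = m ℕ.^ k
        ℓ = m ℕ.^ suc k
        Dʳ = fromℕ D
        ℓʳ = fromℕ ℓ
        1≤D : 1 ℕ.≤ D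
        1≤D = ℕ.m^n>0 m k
        1≤ℓ : 1 ℕ.≤ ℓ
        1≤ℓ = ℕ.m^n>0 m (suc k)
        1≤ℓʳ = 1≤fromℕ 1≤ℓ
        m≤ℓ : m ℕ.≤ ℓ
        m≤ℓ = ℕ.≤-trans (ℕ.≤-reflexive (≡.sym (ℕ.*-identityʳ m))) (ℕ.*-monoʳ-≤ m 1≤D)
        ℓ≈ : ℓʳ ≈ mʳ * Dʳ
        ℓ≈ = fromℕ-* m D
        Δ₀ = δ ℕ.* (D ℕ.* D)
        Δ₀≈ : fromℕ Δ₀ ≈ δʳ * (Dʳ * Dʳ)
        Δ₀≈ = trans (fromℕ-* δ (D ℕ.* D)) (*-congˡ (fromℕ-* D D))
        -- Dropping the logarithmic factor of δ costs nothing here: only ln Δ₀ ≥ 2 ln ℓ = 2 K ln m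
        -- is wanted from it.
        ℓ²≤Δ₀ : ℓʳ * ℓʳ ≤ fromℕ Δ₀
        ℓ²≤Δ₀ = begin
          ℓʳ * ℓʳ                   ≈⟨ *-cong ℓ≈ ℓ≈ ⟩
          (mʳ * Dʳ) * (mʳ * Dʳ)     ≈⟨ solve 2 (λ m D → (m :* D) :* (m :* D) := (m :* m) :* (D :* D)) refl mʳ Dʳ ⟩
          (mʳ * mʳ) * (Dʳ * Dʳ)     ≈⟨ *-congʳ M≈ ⟨
          Mʳ * (Dʳ * Dʳ)            ≤⟨ *-monoʳ-≤ _ (*-nonNeg (0≤fromℕ D) (0≤fromℕ D)) (fromℕ-mono-≤ M≤δ) ⟩
          δʳ * (Dʳ * Dʳ)            ≈⟨ Δ₀≈ ⟨
          fromℕ Δ₀                  ∎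
        2Kl≤lnΔ₀ : K * l + K * l ≤ ln (fromℕ Δ₀)
        2Kl≤lnΔ₀ = begin
          K * l + K * l             ≈⟨ +-cong lnℓ≈ lnℓ≈ ⟨
          ln ℓʳ + ln ℓʳ             ≈⟨ ln-* 1≤ℓʳ 1≤ℓʳ ⟨
          ln (ℓʳ * ℓʳ)              ≤⟨ ln-mono-≤ (1≤* 1≤ℓʳ 1≤ℓʳ) ℓ²≤Δ₀ ⟩
          ln (fromℕ Δ₀)             ∎
          where
          lnℓ≈ : ln ℓʳ ≈ K * l
          lnℓ≈ = trans (ln-cong 1≤ℓʳ (fromℕ-^ m (suc k))) (ln-^ 1≤mʳ (suc k))
        -- This says that α √(N / ln N) is at most ℓ, squared and cleared of the division.
        P : ℕ → Set
        P N = α² * fromℕ N ≤ ℓʳ * ℓʳ * ln (fromℕ N)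
        -- α² ≤ m ε ≤ ε m² ln m absorbs the rounding of δ.
        main : α² * δʳ ≤ Mʳ * (K * l + K * l)
        main = ≤-diff (+-nonNeg (+-nonNeg (+-nonNeg
            (*-nonNeg (≤-trans 0≤1 1≤α²) (x≤y⇒0≤y-x δ₀≤))
            (x≤y⇒0≤y-x α²≤mε))
            (x≤y⇒0≤y-x mε≤Mεl))
            (*-nonNeg (*-nonNeg (0≤fromℕ M) (<⇒≤ 0<ε)) 0≤l))
          (trans (+-congʳ (+-congʳ (+-congʳ (*-congˡ (+-congʳ (*-congˡ lnM≈))))))
          (solve 6 (λ a M K l d m → (a :* (M :* (l :+ l) :- d) :+ (m :* (K :- a) :- a) :+ (M :* (K :- a) :* l :- m :* (K :- a))) :+ M :* (K :- a) :* l
                   := M :* (K :* l :+ K :* l) :- a :* (c1 :+ d)) refl α² Mʳ K l (fromℕ δ₀) mʳ))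
          where
          mε≤Mεl : mʳ * ε ≤ Mʳ * ε * l
          mε≤Mεl = begin
            mʳ * ε          ≈⟨ *-identityʳ _ ⟨
            mʳ * ε * 1#     ≤⟨ *-mono-≤ (*-nonNeg (0≤fromℕ m) (<⇒≤ 0<ε)) 0≤1
                                 (*-monoʳ-≤ ε (<⇒≤ 0<ε) (fromℕ-mono-≤ m≤M)) 1≤l ⟩
            Mʳ * ε * l      ∎
        -- The degrees needed by the construction lie below the threshold, so the search for Δ can
        -- start at Δ₀ and the missing degree can be added.
        PΔ₀ : P Δ₀
        PΔ₀ = begin
          α² * fromℕ Δ₀                         ≈⟨ *-congˡ Δ₀≈ ⟩
          α² * (δʳ * (Dʳ * Dʳ))                 ≈⟨ *-assoc _ _ _ ⟨
          α² * δʳ * (Dʳ * Dʳ)                   ≤⟨ *-monoʳ-≤ _ (*-nonNeg (0≤fromℕ D) (0≤fromℕ D))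
                                                     (≤-trans main (*-monoˡ-≤ Mʳ (0≤fromℕ M) 2Kl≤lnΔ₀)) ⟩
          Mʳ * ln (fromℕ Δ₀) * (Dʳ * Dʳ)        ≈⟨ *-congʳ (*-congʳ M≈) ⟩
          (mʳ * mʳ) * ln (fromℕ Δ₀) * (Dʳ * Dʳ)
              ≈⟨ solve 3 (λ m D x → (m :* m) :* x :* (D :* D) := (m :* D) :* (m :* D) :* x) refl mʳ Dʳ (ln (fromℕ Δ₀)) ⟩
          (mʳ * Dʳ) * (mʳ * Dʳ) * ln (fromℕ Δ₀) ≈⟨ *-congʳ (*-cong ℓ≈ ℓ≈) ⟨
          ℓʳ * ℓʳ * ln (fromℕ Δ₀)               ∎
        above = eventually-above ℓ Δ₀
        threshold = lastBefore P (proj₁ (proj₂ above)) PΔ₀ (proj₂ (proj₂ above))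
        Δ = proj₁ threshold
        Δ₀≤Δ = proj₁ (proj₂ threshold)
        Δʳ = fromℕ Δ
        2≤Δ : 2 ℕ.≤ Δ
        2≤Δ = ℕ.≤-trans (ℕ.≤-trans 2≤M M≤δ) (ℕ.≤-trans (ℕ.m≤m*n δ (D ℕ.* D) {{ℕ.>-nonZero (ℕ.*-mono-≤ 1≤D 1≤D)}}) Δ₀≤Δ)
        1≤lnΔ : 1# ≤ ln Δʳ
        1≤lnΔ = ≤-trans 1≤l (exp-cancel-≤ (begin
          exp l       ≈⟨ exp-ln 1≤mʳ ⟩
          mʳ
              ≤⟨ fromℕ-mono-≤ (ℕ.≤-trans m≤M (ℕ.≤-trans M≤δ (ℕ.≤-trans (ℕ.m≤m*n δ (D ℕ.* D) {{ℕ.>-nonZero (ℕ.*-mono-≤ 1≤D 1≤D)}}) Δ₀≤Δ))) ⟩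
          Δʳ          ≈⟨ exp-ln (1≤fromℕ (ℕ.≤-trans (ℕ.s≤s ℕ.z≤n) 2≤Δ)) ⟨
          exp (ln Δʳ) ∎))
        -- A power does not reduce to a successor, while the ceiling is computed from the
        -- predecessor of ℓ; hence the general n.
        ceiling : ∀ n → n ≡ ℓ → ⌈ α * √ (Δʳ / ln Δʳ) ⌉ ≡ + n
        ceiling zero    0≡ℓ = ⊥-elim (ℕ.<⇒≢ 1≤ℓ 0≡ℓ)
        ceiling (suc ℓ′) eq = ⌈⌉-at-threshold ℓ′ Δ 2≤Δ 1≤lnΔ
          (≡.subst (λ n → α² ≤ fromℕ n) (≡.sym eq) (≤-trans α²≤m (fromℕ-mono-≤ m≤ℓ)))
          (≡.subst (λ n → α² * Δʳ ≤ fromℕ n * fromℕ n * ln Δʳ) (≡.sym eq) (proj₁ (proj₂ (proj₂ threshold))))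
          (≡.subst (λ n → ¬ α² * fromℕ (suc Δ) ≤ fromℕ n * fromℕ n * ln (fromℕ (suc Δ))) (≡.sym eq) (proj₂ (proj₂ (proj₂ threshold))))

       parameters′ : f α ≈ 1# - K ⁻¹ → Parameters α
       parameters′ f≈ = record
        { m = m ; k = k ; δ = δ ; Δ = Δ ; 2≤m = 2≤m ; 1≤δ = ℕ.s≤s ℕ.z≤n
        ; decay = power-decay M δ 2≤M <δ
        ; δD²≤Δ = Δ₀≤Δ ; 2≤Δ = 2≤Δ ; ℓ≡ = ≡.sym (ceiling ℓ ≡.refl) ; D≈ = m^k≈ {α} {k} f≈ m 1≤m }

      parameters : f α ≈ 1# - K ⁻¹ → Parameters α
      parameters = let (δ₀ , δ₀≤ , <δ) = natFloor (*-nonNeg (0≤fromℕ M) (≤-trans 0≤1 1≤lnM)) in parameters′ δ₀ δ₀≤ <δ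

    archimedeanParameters : ∀ k → α² < fromℕ (suc k) → f α ≈ 1# - fromℕ (suc k) ⁻¹ → Parameters α
    archimedeanParameters k α²<K =
      let ε = fromℕ (suc k) - α²
          0<ε = x<y⇒0<y-x α²<K
          (m₁ , h₁) = archimedean (exp 1#)
          (m₂ , h₂) = archimedean α²
          (m₃ , h₃) = archimedean (α² / ε)
          m₁≤m = ℕ.≤-trans (ℕ.m≤m+n m₁ m₂) (ℕ.m≤m+n (m₁ ℕ.+ m₂) m₃)
          m₂≤m = ℕ.≤-trans (ℕ.m≤n+m m₂ m₁) (ℕ.m≤m+n (m₁ ℕ.+ m₂) m₃)
          m₃≤m = ℕ.m≤n+m m₃ (m₁ ℕ.+ m₂)
      in parameters k (m₁ ℕ.+ m₂ ℕ.+ m₃) α²<K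
           (≤-trans (<⇒≤ h₁) (fromℕ-mono-≤ m₁≤m)) (≤-trans (<⇒≤ h₂) (fromℕ-mono-≤ m₂≤m))
           (≤-respˡ-≈ (/-*-cancel α² 0<ε) (*-monoʳ-≤ ε (<⇒≤ 0<ε) (≤-trans (<⇒≤ h₃) (fromℕ-mono-≤ m₃≤m))))

    suitableParameters : Parameters α
    suitableParameters = let (n , _ , α²<2^ , f≈) = f-spec 1≤α in choose (2 ℕ.^ suc n) (ℕ.m^n>0 2 (suc n)) α²<2^ f≈
      where
      choose : ∀ K → 0 ℕ.< K → α² < fromℕ K → f α ≈ 1# - fromℕ K ⁻¹ → Parameters α
      choose (suc k) _ = archimedeanParameters k

-- Counting, greedy labels, and how many vertices an edge may serve

module GreedyLabels where

  open import Algebra.Properties.CommutativeMonoid.Sum ℕ.+-0-commutativeMonoid using (∑-distrib-+; sum-cong-≗) renaming (sum to ∑)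
  open import Data.Fin.Base as Fin using (Fin; zero; suc; finToFun; funToFin; combine; remQuot)
  import Data.Fin.Properties as Fin
  open import Data.List.Base using (List; []; _∷_; length; filter; allFin; lookup)
  import Data.List.Properties as List
  open import Data.List.Membership.Propositional using (_∈_)
  open import Data.List.Membership.Propositional.Properties using (∈-filter⁺; ∈-filter⁻; ∈-lookup; ∈-allFin)
  open import Data.List.Relation.Unary.All as All using ()
  open import Data.List.Relation.Unary.AllPairs using (_∷_)
  open import Data.List.Relation.Unary.Any using (index)
  open import Data.List.Relation.Unary.Any.Properties using (lookup-index)
  open import Data.List.Relation.Unary.Unique.Propositional using (Unique)
  open import Data.List.Relation.Unary.Unique.Propositional.Properties using (filter⁺; allFin⁺)
  open import Data.Nat.Base using (_+_; _*_; _^_; _≤_; _<_; z≤n; s≤s)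
  open import Data.Nat.Properties
  open import Data.Nat.Solver using (module +-*-Solver)
  import Data.Vec.Functional as Vector
  open import Relation.Binary.PropositionalEquality
  open import Relation.Unary using (Decidable)

  lookup-injective : ∀ {A : Set} {xs : List A} → Unique xs → ∀ {i j} → lookup xs i ≡ lookup xs j → i ≡ j
  lookup-injective (_ ∷ _)  {zero}  {zero}  _  = refl
  lookup-injective (x∉ ∷ _) {zero}  {suc j} eq = ⊥-elim (All.lookup x∉ (∈-lookup j) eq)
  lookup-injective (x∉ ∷ _) {suc i} {zero}  eq = ⊥-elim (All.lookup x∉ (∈-lookup i) (sym eq))
  lookup-injective (_ ∷ u)  {suc i} {suc j} eq = cong suc (lookup-injective u eq)

  module _ {n k : ℕ} {P : Fin n → Set} (P? : Decidable P) where

    -- Positions in the filtered list are distinct indices, since `allFin` has no repetitions. The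
    -- slot receives the proof of P because it may depend on the orientation in which an edge is
    -- read.
    count-≤ : (slot : ∀ i → P i → Fin k) → (∀ {i j} (p : P i) (q : P j) → slot i p ≡ slot j q → i ≡ j) →
              length (filter P? (allFin n)) ≤ k
    count-≤ slot slot-injective =
      Fin.injective⇒≤ {f = λ i → slot (lookup xs i) (holds i)}
        λ eq → lookup-injective (filter⁺ P? (allFin⁺ n)) (slot-injective (holds _) (holds _) eq)
      where
      xs = filter P? (allFin n)
      holds : ∀ i → P (lookup xs i)
      holds i = proj₂ (∈-filter⁻ P? {xs = allFin n} (∈-lookup i))

    count-≥ : (g : Fin k → Fin n) → (∀ {i j} → g i ≡ g j → i ≡ j) → (∀ i → P (g i)) →
              k ≤ length (filter P? (allFin n))
    count-≥ g g-injective holds = Fin.injective⇒≤ {f = λ i → index (member i)} λ {i} {j} eq → g-injective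
      (trans (lookup-index (member i)) (trans (cong (lookup xs) eq) (sym (lookup-index (member j)))))
      where
      xs = filter P? (allFin n)
      member : ∀ i → g i ∈ xs
      member i = ∈-filter⁺ P? (∈-allFin (g i)) (holds i)

  ∑-≥ : ∀ {n} c (g : Fin n → ℕ) → (∀ i → c ≤ g i) → n * c ≤ ∑ g
  ∑-≥ {zero}  c g h = z≤n
  ∑-≥ {suc n} c g h = +-mono-≤ (h zero) (∑-≥ c (g ∘ suc) (h ∘ suc))

  minimum : ∀ {n} (g : Fin (suc n) → ℕ) → ∃ λ i → ∀ j → g i ≤ g j
  minimum {zero}  g = zero , λ { zero → ≤-refl }
  minimum {suc n} g with minimum (g ∘ suc)
  ... | i , least with ≤-total (g zero) (g (suc i))
  ...   | inj₁ le = zero , λ { zero → ≤-refl ; (suc j) → ≤-trans le (least j) }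
  ...   | inj₂ ge = suc i , λ { zero → ge ; (suc j) → least j }

  module _ {C : Set} where

    -- Here c is a colouring, `g c` encodes the pair of colours it gives to the ends of the current
    -- edge, and t is a candidate label for that edge.
    survivors : ∀ {M} → (C → Fin M) → List C → Fin M → List C
    survivors g S t = filter (λ c → ¬? (g c Fin.≟ t)) S

    mismatch : ∀ {M} → Fin M → Fin M → ℕ
    mismatch x t with x Fin.≟ t
    ... | yes _ = 0
    ... | no  _ = 1

    ∑-mismatch : ∀ {M} (x : Fin (suc M)) → ∑ (mismatch x) ≡ M
    ∑-mismatch {zero}  zero    = refl
    ∑-mismatch {suc M} zero    = cong suc (∑-ones M)
      where
      ∑-ones : ∀ n → ∑ {n} (λ _ → 1) ≡ n
      ∑-ones zero    = refl
      ∑-ones (suc n) = cong suc (∑-ones n)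
    ∑-mismatch {suc M} (suc x) = cong suc (trans (sum-cong-≗ step) (∑-mismatch x))
      where
      step : ∀ t → mismatch (suc x) (suc t) ≡ mismatch x t
      step t with x Fin.≟ t
      ... | yes _ = refl
      ... | no  _ = refl

    -- Double counting: every colouring survives all of the M + 1 labels but one.
    ∑-survivors : ∀ {M} (g : C → Fin (suc M)) S → ∑ (length ∘ survivors g S) ≡ length S * M
    ∑-survivors {M} g []      = ∑-zeros (suc M)
      where
      ∑-zeros : ∀ n → ∑ {n} (λ _ → 0) ≡ 0
      ∑-zeros zero    = refl
      ∑-zeros (suc n) = ∑-zeros n
    ∑-survivors {M} g (c ∷ S) = trans (sum-cong-≗ step)
      (trans (∑-distrib-+ (mismatch (g c)) (length ∘ survivors g S)) (cong₂ _+_ (∑-mismatch (g c)) (∑-survivors g S)))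
      where
      step : ∀ t → length (survivors g (c ∷ S) t) ≡ mismatch (g c) t + length (survivors g S t)
      step t with g c Fin.≟ t
      ... | yes _ = refl
      ... | no  _ = refl

    -- The least of the M + 1 counts is at most their average.
    fewSurvivors : ∀ {M} (g : C → Fin (suc M)) S → ∃ λ t → suc M * length (survivors g S t) ≤ length S * M
    fewSurvivors g S = let (t , least) = minimum (length ∘ survivors g S) in
      t , ≤-trans (∑-≥ (length (survivors g S t)) (length ∘ survivors g S) least) (≤-reflexive (∑-survivors g S))

    -- Each edge cuts the surviving colourings to at most M / (M + 1) of their number. The
    -- hypothesis is preserved, and with no edges left it says that fewer than one colouring
    -- survives.
    greedyLabels : ∀ {M} E (g : Fin E → C → Fin (suc M)) S → length S * M ^ E < suc M ^ E →
      ∃ λ (label : Fin E → Fin (suc M)) → ∀ c → c ∈ S → ∃ λ e → g e c ≡ label e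
    greedyLabels zero    g []      _ = (λ ()) , λ _ ()
    greedyLabels zero    g (_ ∷ _) (s≤s ())
    greedyLabels {M} (suc E) g S h =
      let (t , few) = fewSurvivors (g zero) S
          S′ = survivors (g zero) S t
          h′ : length S′ * M ^ E < suc M ^ E
          h′ = *-cancelˡ-< (suc M) _ _ (begin-strict
            suc M * (length S′ * M ^ E)   ≡⟨ *-assoc (suc M) (length S′) (M ^ E) ⟨
            suc M * length S′ * M ^ E     ≤⟨ *-monoˡ-≤ (M ^ E) few ⟩
            length S * M * M ^ E          ≡⟨ *-assoc (length S) M (M ^ E) ⟩
            length S * M ^ suc E          <⟨ h ⟩
            suc M ^ suc E                 ∎)
          (label , kills) = greedyLabels E (g ∘ suc) S′ h′
      in (t Vector.∷ label) , killed t label kills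
      where
      open ≤-Reasoning
      killed : ∀ t (label : Fin E → Fin (suc M)) → (∀ c → c ∈ survivors (g zero) S t → ∃ λ e → g (suc e) c ≡ label e) →
        ∀ c → c ∈ S → ∃ λ e → g e c ≡ (t Vector.∷ label) e
      killed t label kills c c∈S with g zero c Fin.≟ t
      ... | yes eq = zero , eq
      ... | no neq = let (e , eq) = kills c (∈-filter⁺ (λ c → ¬? (g zero c Fin.≟ t)) c∈S neq) in suc e , eq

  unavoidableLabels : ∀ {m E n} → 2 ≤ m → (s t : Fin E → Fin n) → m ^ n * (m * m ∸ 1) ^ E < (m * m) ^ E →
    ∃ λ (label : Fin E → Fin m × Fin m) → ∀ (γ : Fin n → Fin m) → ∃ λ e → label e ≡ (γ (s e) , γ (t e))
  unavoidableLabels {m} {E} {n} 2≤m s t h = go (m * m) refl (≤-trans (s≤s z≤n) (*-mono-≤ 2≤m 2≤m)) h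
    where
    go : ∀ M → M ≡ m * m → 1 ≤ M → m ^ n * (M ∸ 1) ^ E < M ^ E →
         ∃ λ (label : Fin E → Fin m × Fin m) → ∀ (γ : Fin n → Fin m) → ∃ λ e → label e ≡ (γ (s e) , γ (t e))
    go (suc M) eq _ h = (λ e → remQuot m (to (label e))) , λ γ →
        let (e , p) = kills (funToFin γ) (∈-allFin (funToFin γ))
            -- Decoding returns γ only pointwise, which is enough because only the two ends of e are
            -- evaluated.
            γ≗ = Fin.finToFun-funToFin γ
        in e , trans (cong (remQuot m) (trans (cong to (sym p)) (Fin.cast-involutive eq (sym eq) _)))
                 (trans (Fin.remQuot-combine _ _) (cong₂ _,_ (γ≗ (s e)) (γ≗ (t e))))
      where
      to : Fin (suc M) → Fin (m * m)
      to = Fin.cast eq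
      g : Fin E → Fin (m ^ n) → Fin (suc M)
      g e c = Fin.cast (sym eq) (combine (finToFun c (s e)) (finToFun c (t e)))
      length-allFin : length (allFin (m ^ n)) ≡ m ^ n
      length-allFin = List.length-tabulate (λ i → i)
      greedy = greedyLabels E g (allFin (m ^ n)) (subst (λ N → N * M ^ E < suc M ^ E) (sym length-allFin) h)
      label = proj₁ greedy
      kills = proj₂ greedy

  -- Bernoulli's inequality 1 + Q/A ≤ (1 + 1/A) ^ Q with denominators cleared.
  bernoulli : ∀ A Q → A ^ Q * (A + Q) ≤ A * suc A ^ Q
  bernoulli A zero    = ≤-reflexive (solve 1 (λ a → con 1 :* (a :+ con 0) := a :* con 1) refl A)
    where open +-*-Solver
  bernoulli A (suc Q) = begin
    A * A ^ Q * (A + suc Q)         ≤⟨ m≤m+n _ (A ^ Q * Q) ⟩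
    A * A ^ Q * (A + suc Q) + A ^ Q * Q
        ≡⟨ solve 3 (λ a p q → a :* p :* (a :+ (con 1 :+ q)) :+ p :* q := (con 1 :+ a) :* (p :* (a :+ q))) refl A (A ^ Q) Q ⟩
    suc A * (A ^ Q * (A + Q))       ≤⟨ *-monoʳ-≤ (suc A) (bernoulli A Q) ⟩
    suc A * (A * suc A ^ Q)         ≡⟨ solve 2 (λ a p → (con 1 :+ a) :* (a :* p) := a :* ((con 1 :+ a) :* p)) refl A (suc A ^ Q) ⟩
    A * (suc A * suc A ^ Q)         ∎
    where open ≤-Reasoning
          open +-*-Solver

  -- As B ≥ A + 1, Bernoulli gives (B/A) ^ Q ≥ 1 + Q/A > c.
  power-gap : ∀ {A B} c Q → 1 ≤ A → A < B → A * c ≤ Q → c * A ^ Q < B ^ Q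
  power-gap {A} {B} c Q 1≤A A<B Ac≤Q = *-cancelˡ-< A _ _ (begin-strict
    A * (c * A ^ Q)           <⟨ m<n+m _ (*-mono-≤ 1≤A (m^n>0 A {{ℕ.>-nonZero 1≤A}} Q)) ⟩
    A * A ^ Q + A * (c * A ^ Q) ≡⟨ solve 3 (λ a c p → a :* p :+ a :* (c :* p) := p :* (a :+ a :* c)) refl A c (A ^ Q) ⟩
    A ^ Q * (A + A * c)       ≤⟨ *-monoʳ-≤ (A ^ Q) (+-monoʳ-≤ A Ac≤Q) ⟩
    A ^ Q * (A + Q)           ≤⟨ bernoulli A Q ⟩
    A * suc A ^ Q             ≤⟨ *-monoʳ-≤ A (^-monoˡ-≤ Q A<B) ⟩
    A * B ^ Q                 ∎)
    where open ≤-Reasoning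
          open +-*-Solver

  -- n = δ q + (δ (q + δ²) + 2) vertices and δ² q edges: the number of vertices per edge tends to 2/δ as q grows.
  manyVertices : ∀ {m δ} → 2 ≤ m → m * m * (m * m ∸ 1) ^ δ < (m * m) ^ δ →
    ∃ λ q → 1 ≤ q × m ^ (δ * q + (δ * (q + δ * δ) + 2)) * (m * m ∸ 1) ^ (δ * q * δ) < (m * m) ^ (δ * q * δ)
  manyVertices {m} {zero}  2≤m h = ⊥-elim (<⇒≱ h (≤-trans (*-mono-≤ 1≤m 1≤m) (m≤m*n (m * m) 1)))
    where 1≤m = ≤-trans (s≤s z≤n) 2≤m
  manyVertices {m} {δ@(suc _)} 2≤m h = q , 1≤q , (begin-strict
    m ^ (δ * q + (δ * (q + δ * δ) + 2)) * N ^ (Q * δ)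
        ≡⟨ cong₂ _*_ split (trans (cong (N ^_) (*-comm Q δ)) (sym (^-*-assoc N δ Q))) ⟩
    c * (m * m) ^ Q * (N ^ δ) ^ Q                      ≡⟨ *-assoc c _ _ ⟩
    c * ((m * m) ^ Q * (N ^ δ) ^ Q)                    ≡⟨ cong (c *_) (^-distribʳ-* Q (m * m) (N ^ δ)) ⟨
    c * A ^ Q                                          <⟨ power-gap c Q 1≤A h (m≤n*m q δ) ⟩
    ((m * m) ^ δ) ^ Q                                  ≡⟨ ^-*-assoc (m * m) δ Q ⟩
    (m * m) ^ (δ * Q)                                  ≡⟨ cong ((m * m) ^_) (*-comm δ Q) ⟩
    (m * m) ^ (Q * δ)                                  ∎)
    where
    open ≤-Reasoning
    open +-*-Solver
    N = m * m ∸ 1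
    A = m * m * N ^ δ
    -- The colourings of the δ³ + 2 vertices in excess of 2 δ q. This number does not depend on q,
    -- so q may be taken as large as `power-gap` asks.
    c = m ^ (δ * (δ * δ) + 2)
    q = A * c
    Q = δ * q
    1≤m = ≤-trans (s≤s z≤n) 2≤m
    1≤N : 1 ≤ N
    1≤N = ∸-monoˡ-≤ 1 (≤-trans 2≤m (m≤m*n m m {{ℕ.>-nonZero 1≤m}}))
    1≤A : 1 ≤ A
    1≤A = *-mono-≤ (*-mono-≤ 1≤m 1≤m) (m^n>0 N {{ℕ.>-nonZero 1≤N}} δ)
    1≤q : 1 ≤ q
    1≤q = *-mono-≤ 1≤A (m^n>0 m {{ℕ.>-nonZero 1≤m}} (δ * (δ * δ) + 2))
    ^-distribʳ-* : ∀ Q a b → (a * b) ^ Q ≡ a ^ Q * b ^ Q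
    ^-distribʳ-* zero    a b = refl
    ^-distribʳ-* (suc Q) a b = trans (cong (a * b *_) (^-distribʳ-* Q a b))
      (solve 4 (λ a b p r → (a :* b) :* (p :* r) := (a :* p) :* (b :* r)) refl a b (a ^ Q) (b ^ Q))
    split : m ^ (δ * q + (δ * (q + δ * δ) + 2)) ≡ c * (m * m) ^ Q
    split =
      trans (cong (m ^_) (solve 2 (λ d q → d :* q :+ (d :* (q :+ d :* d) :+ con 2) := (d :* (d :* d) :+ con 2) :+ (d :* q :+ d :* q)) refl δ q))
      (trans (^-distribˡ-+-* m (δ * (δ * δ) + 2) (Q + Q)) (cong (c *_) (trans (^-distribˡ-+-* m Q Q) (sym (^-distribʳ-* Q m m)))))

-- The multigraph of points and lines with bundled edges

module BlownUpPlane where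

  open import Data.Bool.Base using (Bool; true; false; not)
  open import Data.Fin.Base as Fin using (Fin; zero; suc; toℕ; fromℕ<; combine; remQuot; inject≤)
  import Data.Fin.Properties as Fin
  open import Data.List.Base using (upTo)
  import Data.List.Properties as List
  open import Data.List.Membership.Propositional.Properties using (∈-upTo⁻)
  open import Data.List.Relation.Unary.Unique.Propositional.Properties using (upTo⁺)
  open import Data.Nat.Base using (_+_; _*_; _^_; _≤_; _<_)
  open import Data.Nat.Properties
  open import Data.Nat.Solver using (module +-*-Solver)
  open import Data.Product.Function.NonDependent.Propositional using (_×-↔_)
  open import Data.Sum.Function.Propositional using (_⊎-↔_)
  open import Function.Bundles using (_↔_; module Inverse)
  open import Function.Construct.Composition using (_↔-∘_)
  open import Function.Construct.Identity using (↔-id)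
  open import Relation.Binary.PropositionalEquality
  open GreedyLabels using (count-≤; count-≥; unavoidableLabels; manyVertices)

  -- The equation is (a - b)(x - x′) = 0 written without subtraction.
  cross-cancel : ∀ {a b x x′} → a * x + b * x′ ≡ a * x′ + b * x → a ≡ b ⊎ x ≡ x′
  cross-cancel {zero}  {zero}  eq = inj₁ refl
  cross-cancel {zero}  {suc b} eq = inj₂ (sym (*-cancelˡ-≡ _ _ (suc b) eq))
  cross-cancel {suc a} {zero}  {x} {x′} eq =
    inj₂ (*-cancelˡ-≡ x x′ (suc a) (trans (sym (+-identityʳ _)) (trans eq (+-identityʳ _))))
  cross-cancel {suc a} {suc b} {x} {x′} eq with cross-cancel {a} {b} {x} {x′} (+-cancelˡ-≡ (x + x′) _ _
    (trans (solve 4 (λ a b x y → (x :+ y) :+ (a :* x :+ b :* y) := (con 1 :+ a) :* x :+ (con 1 :+ b) :* y) refl a b x x′)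
      (trans eq (solve 4 (λ a b x y → (con 1 :+ a) :* y :+ (con 1 :+ b) :* x := (x :+ y) :+ (a :* y :+ b :* x)) refl a b x x′))))
    where open +-*-Solver
  ... | inj₁ a≡b  = inj₁ (cong suc a≡b)
  ... | inj₂ x≡x′ = inj₂ x≡x′

  module Construction (m D δ q Δ : ℕ) where

    -- The line y = b - a x is indexed by (a , b) with b < w, so that each point lies on a line of every slope a.
    w : ℕ
    w = q + δ * δ

    Vertex Edge : Set
    Vertex = (Fin δ × Fin q) ⊎ ((Fin δ × Fin w) ⊎ Fin 2)
    Edge = (((Fin δ × Fin q) × Fin δ) × (Fin D × Fin D)) ⊎ Fin Δ

    -- Each incident point and line are joined by D² parallel edges. The spare edges, a separate bundle between two further
    -- vertices, raise the maximum degree to exactly Δ.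
    pattern point x y = inj₁ (x , y)
    pattern line a b  = inj₂ (inj₁ (a , b))
    pattern spare i   = inj₂ (inj₂ i)
    pattern edge x y a i j = inj₁ (((x , y) , a) , (i , j))
    pattern spareEdge i    = inj₂ i

    n ε : ℕ
    n = δ * q + (δ * w + 2)
    ε = δ * q * δ

    V↔ : Fin n ↔ Vertex
    V↔ = (Fin.*↔× ⊎-↔ ((Fin.*↔× ⊎-↔ ↔-id _) ↔-∘ Fin.+↔⊎)) ↔-∘ Fin.+↔⊎

    H↔ : Fin ε ↔ ((Fin δ × Fin q) × Fin δ)
    H↔ = (Fin.*↔× ×-↔ ↔-id _) ↔-∘ Fin.*↔×

    E↔ : Fin (ε * (D * D) + Δ) ↔ Edge
    E↔ = (((H↔ ×-↔ Fin.*↔×) ↔-∘ Fin.*↔×) ⊎-↔ ↔-id _) ↔-∘ Fin.+↔⊎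

    module V = Inverse V↔
    module H = Inverse H↔
    module E = Inverse E↔

    -- Because y < q and a x ≤ δ², lines never wrap around. Two points on two common lines are then
    -- excluded by cancellation in ℕ, whatever δ and q are.
    through<w : ∀ (x : Fin δ) (y : Fin q) (a : Fin δ) → toℕ y + toℕ a * toℕ x < w
    through<w x y a = +-mono-<-≤ (Fin.toℕ<n y) (*-mono-≤ (<⇒≤ (Fin.toℕ<n a)) (<⇒≤ (Fin.toℕ<n x)))

    through : Fin δ → Fin q → Fin δ → Fin w
    through x y a = fromℕ< (through<w x y a)

    toℕ-through : ∀ x y a → toℕ (through x y a) ≡ toℕ y + toℕ a * toℕ x
    toℕ-through x y a = Fin.toℕ-fromℕ< (through<w x y a)

    src tgt : Edge → Vertex
    src (edge x y a i j) = point x y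
    src (spareEdge _)    = spare zero
    tgt (edge x y a i j) = line a (through x y a)
    tgt (spareEdge _)    = spare (suc zero)

    line-injective : ∀ {a a′ b b′} → _≡_ {A = Vertex} (line a b) (line a′ b′) → a ≡ a′ × b ≡ b′
    line-injective refl = refl , refl

    pointEnd lineEnd : Fin ε → Fin n
    pointEnd h = let ((x , y) , a) = H.to h in V.from (point x y)
    lineEnd h  = let ((x , y) , a) = H.to h in V.from (line a (through x y a))

    -- The bipartition. All edges run from `true` to `false`, which excludes loops and triangles and
    -- keeps the two readings of a label apart.
    isSource : Vertex → Bool
    isSource (point _ _) = true
    isSource (line _ _)  = false
    isSource (spare zero)       = true
    isSource (spare (suc zero)) = false

    isSource-src : ∀ e → isSource (src e) ≡ true
    isSource-src (edge _ _ _ _ _) = refl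
    isSource-src (spareEdge _)    = refl

    isSource-tgt : ∀ e → isSource (tgt e) ≡ false
    isSource-tgt (edge _ _ _ _ _) = refl
    isSource-tgt (spareEdge _)    = refl

    src≢tgt : ∀ e e′ → src e ≢ tgt e′
    src≢tgt e e′ eq with trans (sym (isSource-src e)) (trans (cong isSource eq) (isSource-tgt e′))
    ... | ()

    from-injective : ∀ {u v} → V.from u ≡ V.from v → u ≡ v
    from-injective {u} {v} eq = trans (sym (V.strictlyInverseˡ u)) (trans (cong V.to eq) (V.strictlyInverseˡ v))

    V-to-injective : ∀ {u v} → V.to u ≡ V.to v → u ≡ v
    V-to-injective {u} {v} eq = trans (sym (V.strictlyInverseʳ u)) (trans (cong V.from eq) (V.strictlyInverseʳ v))

    E-to-injective : ∀ {u v} → E.to u ≡ E.to v → u ≡ v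
    E-to-injective {u} {v} eq = trans (sym (E.strictlyInverseʳ u)) (trans (cong E.from eq) (E.strictlyInverseʳ v))

    E-from-injective : ∀ {u v} → E.from u ≡ E.from v → u ≡ v
    E-from-injective {u} {v} eq = trans (sym (E.strictlyInverseˡ u)) (trans (cong E.to eq) (E.strictlyInverseˡ v))

    G : Multigraph
    G = record
      { ∣V∣ = n ; ∣E∣ = ε * (D * D) + Δ
      ; source = V.from ∘ src ∘ E.to
      ; target = V.from ∘ tgt ∘ E.to
      ; loopless = λ e eq → src≢tgt (E.to e) (E.to e) (from-injective eq)
      }

    end : ∀ {t v} → V.from t ≡ v → t ≡ V.to v
    end {t} eq = trans (sym (V.strictlyInverseˡ t)) (cong V.to eq)

    module _ (δD²≤Δ : δ * (D * D) ≤ Δ) where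

      Incident : Vertex → Edge → Set
      Incident v e = (src e ≡ v) ⊎ (tgt e ≡ v)

      -- At a point an edge is given by the slope a and its place (i , j) in the bundle; at a line
      -- by x and (i , j), as y is then b - a x. Either way there are δ D² ≤ Δ possibilities.
      slot : ∀ v e → Incident v e → Fin Δ
      slot (point _ _) (edge x y a i j) _ = inject≤ (combine a (combine i j)) δD²≤Δ
      slot (line _ _)  (edge x y a i j) _ = inject≤ (combine x (combine i j)) δD²≤Δ
      slot (spare _)   (spareEdge i)    _ = i
      slot (point _ _) (spareEdge _) (inj₁ ())
      slot (point _ _) (spareEdge _) (inj₂ ())
      slot (line _ _)  (spareEdge _) (inj₁ ())
      slot (line _ _)  (spareEdge _) (inj₂ ())
      slot (spare _) (edge _ _ _ _ _) (inj₁ ())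
      slot (spare _) (edge _ _ _ _ _) (inj₂ ())

      slot-combine : ∀ {x x′ : Fin δ} {i i′ j j′ : Fin D} →
        inject≤ (combine x (combine i j)) δD²≤Δ ≡ inject≤ (combine x′ (combine i′ j′)) δD²≤Δ → x ≡ x′ × i ≡ i′ × j ≡ j′
      slot-combine eq =
        let (x≡ , ij≡) = Fin.combine-injective _ _ _ _ (Fin.inject≤-injective δD²≤Δ δD²≤Δ _ _ eq)
        in x≡ , Fin.combine-injective _ _ _ _ ij≡

      slot-injective : ∀ v e e′ (p : Incident v e) (p′ : Incident v e′) → slot v e p ≡ slot v e′ p′ → e ≡ e′
      slot-injective (point _ _) (edge _ _ a i j) (edge _ _ a′ i′ j′) (inj₁ refl) (inj₁ refl) eq
        with refl , refl , refl ← slot-combine {a} {a′} {i} {i′} {j} {j′} eq = refl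
      slot-injective (line _ _) (edge x y a i j) (edge x′ y′ a′ i′ j′) (inj₂ p) (inj₂ p′) eq
        with refl , refl , refl ← slot-combine {x} {x′} {i} {i′} {j} {j′} eq
        with refl , y≡ ← line-injective (trans p (sym p′))
        with refl ← Fin.toℕ-injective (+-cancelʳ-≡ (toℕ a * toℕ x) (toℕ y) (toℕ y′)
               (trans (sym (toℕ-through x y a)) (trans (cong toℕ y≡) (toℕ-through x y′ a)))) = refl
      slot-injective (spare _) (spareEdge _) (spareEdge _) _ _ refl = refl
      slot-injective (point _ _) (spareEdge _) _ (inj₁ ())
      slot-injective (point _ _) (spareEdge _) _ (inj₂ ())
      slot-injective (point _ _) (edge _ _ _ _ _) (spareEdge _) _ (inj₁ ())
      slot-injective (point _ _) (edge _ _ _ _ _) (spareEdge _) _ (inj₂ ())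
      slot-injective (line _ _) (spareEdge _) _ (inj₁ ())
      slot-injective (line _ _) (spareEdge _) _ (inj₂ ())
      slot-injective (line _ _) (edge _ _ _ _ _) (spareEdge _) _ (inj₁ ())
      slot-injective (line _ _) (edge _ _ _ _ _) (spareEdge _) _ (inj₂ ())
      slot-injective (spare _) (edge _ _ _ _ _) _ (inj₁ ())
      slot-injective (spare _) (edge _ _ _ _ _) _ (inj₂ ())
      slot-injective (spare _) (spareEdge _) (edge _ _ _ _ _) _ (inj₁ ())
      slot-injective (spare _) (spareEdge _) (edge _ _ _ _ _) _ (inj₂ ())

      incident : ∀ {v} e → (V.from (src (E.to e)) ≡ v) ⊎ (V.from (tgt (E.to e)) ≡ v) → Incident (V.to v) (E.to e)
      incident e (inj₁ p) = inj₁ (end p)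
      incident e (inj₂ p) = inj₂ (end p)

      isMaxDegree : IsMaxDegree G Δ
      isMaxDegree = upper , v₀ , ≤-antisym (upper v₀)
          (count-≥ _ (E.from ∘ inj₂) (λ eq → inj₂-injective (E-from-injective eq))
            (λ i → inj₁ (cong (V.from ∘ src) (E.strictlyInverseˡ (inj₂ i)))))
        where
        v₀ = V.from (spare zero)
        inj₂-injective : ∀ {i j} → _≡_ {A = Edge} (inj₂ i) (inj₂ j) → i ≡ j
        inj₂-injective refl = refl
        upper : ∀ v → degree G v ≤ Δ
        upper v = count-≤ _ (λ e p → slot (V.to v) (E.to e) (incident e p))
          (λ {e} {e′} p p′ eq → E-to-injective (slot-injective (V.to v) (E.to e) (E.to e′) (incident e p) (incident e′ p′) eq))

    data Adjacent : Vertex → Vertex → Set where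
      point-line : ∀ {x y a b} → toℕ b ≡ toℕ y + toℕ a * toℕ x → Adjacent (point x y) (line a b)
      line-point : ∀ {x y a b} → toℕ b ≡ toℕ y + toℕ a * toℕ x → Adjacent (line a b) (point x y)
      spare₀₁    : Adjacent (spare zero) (spare (suc zero))
      spare₁₀    : Adjacent (spare (suc zero)) (spare zero)

    adjacent : ∀ e → Adjacent (src e) (tgt e) × Adjacent (tgt e) (src e)
    adjacent (edge x y a i j) = point-line (toℕ-through x y a) , line-point (toℕ-through x y a)
    adjacent (spareEdge i)    = spare₀₁ , spare₁₀

    joins⇒adjacent : ∀ {e u v} → Joins G e u v → Adjacent (V.to u) (V.to v)
    joins⇒adjacent {e} (inj₁ (p , q)) = subst₂ Adjacent (end p) (end q) (proj₁ (adjacent (E.to e)))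
    joins⇒adjacent {e} (inj₂ (p , q)) = subst₂ Adjacent (end q) (end p) (proj₂ (adjacent (E.to e)))

    bipartite : ∀ {u v} → Adjacent u v → isSource u ≡ not (isSource v)
    bipartite (point-line _) = refl
    bipartite (line-point _) = refl
    bipartite spare₀₁        = refl
    bipartite spare₁₀        = refl

    noTriangle : ¬ Cycle G 3
    noTriangle C =
      odd _ (trans (bipartite (adj zero)) (cong not (trans (bipartite (adj (suc zero))) (cong not (bipartite (adj (suc (suc zero))))))))
      where
      odd : ∀ b → b ≢ not (not (not b))
      odd true  ()
      odd false ()
      open Cycle C
      adj : ∀ i → _
      adj i = joins⇒adjacent (joins i)

    -- Two lines through two points: y + a x = y′ + a x′ and y + a′ x = y′ + a′ x′.
    square : ∀ {x x′ : Fin δ} {y y′ : Fin q} {a a′ : Fin δ} {b b′ : Fin w} →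
      toℕ b ≡ toℕ y + toℕ a * toℕ x → toℕ b ≡ toℕ y′ + toℕ a * toℕ x′ →
      toℕ b′ ≡ toℕ y′ + toℕ a′ * toℕ x′ → toℕ b′ ≡ toℕ y + toℕ a′ * toℕ x →
      _≡_ {A = Vertex} (point x y) (point x′ y′) ⊎ _≡_ {A = Vertex} (line a b) (line a′ b′)
    square {x} {x′} {y} {y′} {a} {a′} p p′ q′ q with cross-cancel {toℕ a} {toℕ a′} {toℕ x} {toℕ x′}
        (+-cancelˡ-≡ (toℕ y + toℕ y′) _ _ (trans (shuffle (toℕ y) (toℕ y′) (toℕ a * toℕ x) (toℕ a′ * toℕ x′))
          (trans (cong₂ _+_ (trans (sym p) p′) (trans (sym q′) q))
            (trans (sym (shuffle (toℕ y′) (toℕ y) (toℕ a * toℕ x′) (toℕ a′ * toℕ x)))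
              (cong (_+ (toℕ a * toℕ x′ + toℕ a′ * toℕ x)) (+-comm (toℕ y′) (toℕ y)))))))
      where
      open +-*-Solver
      shuffle : ∀ s t u v → (s + t) + (u + v) ≡ (s + u) + (t + v)
      shuffle = solve 4 (λ s t u v → (s :+ t) :+ (u :+ v) := (s :+ u) :+ (t :+ v)) refl
    ... | inj₁ a≡ with refl ← Fin.toℕ-injective a≡ = inj₂ (cong (λ b → line a b) (Fin.toℕ-injective (trans p (sym q))))
    ... | inj₂ x≡ with refl ← Fin.toℕ-injective x≡ = inj₁ (cong (λ y → point x y) (Fin.toℕ-injective (+-cancelʳ-≡ _ _ _ (trans (sym p) p′))))

    -- Stated for closed walks: two opposite vertices coincide, which the distinct vertices of a
    -- cycle forbid. A walk starting at a line is rotated by one step.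
    noSquare : ∀ {u v u′ v′} → Adjacent u v → Adjacent v u′ → Adjacent u′ v′ → Adjacent v′ u → u ≡ u′ ⊎ v ≡ v′
    noSquare (point-line p) (line-point p′) (point-line q′) (line-point q) = square p p′ q′ q
    noSquare (line-point p) (point-line p′) (line-point q′) (point-line q) with square p′ q′ q p
    ... | inj₁ eq = inj₂ eq
    ... | inj₂ eq = inj₁ (sym eq)
    noSquare spare₀₁ spare₁₀ _ _ = inj₁ refl
    noSquare spare₁₀ spare₀₁ _ _ = inj₁ refl

    no4Cycle : ¬ Cycle G 4
    no4Cycle C with noSquare (adj zero) (adj (suc zero)) (adj (suc (suc zero))) (adj (suc (suc (suc zero))))
      where
      open Cycle C
      adj : ∀ i → _
      adj i = joins⇒adjacent (joins i)
    ... | inj₁ eq = case₁ (Cycle.vertex-injective C (V-to-injective eq))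
      where case₁ : ¬ _≡_ {A = Fin 4} zero (suc (suc zero))
            case₁ ()
    ... | inj₂ eq = case₂ (Cycle.vertex-injective C (V-to-injective eq))
      where case₂ : ¬ _≡_ {A = Fin 4} (suc zero) (suc (suc (suc zero)))
            case₂ ()

    module Labelled (label : Fin ε → Fin m × Fin m) where

      -- The m D colours form m groups of D, combine g i being the i-th of group g: a bundle of D² edges forbids a pair of groups.
      labelT : Edge → ℕ × ℕ
      labelT (inj₁ (h , (i , j))) = let (g , g′) = label (H.from h) in toℕ (combine g i) , toℕ (combine g′ j)
      labelT (inj₂ i)             = toℕ i , toℕ i

      τ : EdgeLabelling G
      τ = labelT ∘ E.to

      L : Lists G
      L _ = upTo (m * D)

      allOfSize : AllOfSize G (m * D) L
      allOfSize _ = upTo⁺ (m * D) , List.length-upTo (m * D)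

      LabelledT : Edge → Vertex → Vertex → ℕ → ℕ → Set
      LabelledT e u v c c′ = (src e ≡ u × tgt e ≡ v × labelT e ≡ (c , c′)) ⊎ (src e ≡ v × tgt e ≡ u × labelT e ≡ (c′ , c))

      labelledT : ∀ {e u v c c′} → Labelled G τ e u v c c′ → LabelledT (E.to e) (V.to u) (V.to v) c c′
      labelledT (inj₁ (p , q , r)) = inj₁ (end p , end q , r)
      labelledT (inj₂ (p , q , r)) = inj₂ (end p , end q , r)

      module _ (1≤D : 1 ≤ D) where

        -- Edges between the same vertices with the same colour at u differ only in the colour within the group at v.
        free : ∀ {u v c c′} e → LabelledT e u v c c′ → Fin D
        free (edge _ _ _ i j) (inj₁ _) = j
        free (edge _ _ _ i j) (inj₂ _) = i
        free (spareEdge _)    _        = fromℕ< 1≤D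

        parallel : ∀ {x y a i j x′ y′ a′ i′ j′} → src (edge x y a i j) ≡ src (edge x′ y′ a′ i′ j′) →
                   tgt (edge x y a i j) ≡ tgt (edge x′ y′ a′ i′ j′) → x ≡ x′ × y ≡ y′ × a ≡ a′
        parallel refl eq = refl , refl , proj₁ (line-injective eq)

        point≢spare : ∀ {x y} → ¬ _≡_ {A = Vertex} (point x y) (spare zero)
        point≢spare ()

        free-injective : ∀ {u v c c′ c″} e e′ (p : LabelledT e u v c c′) (p′ : LabelledT e′ u v c c″) → free e p ≡ free e′ p′ → e ≡ e′
        free-injective (edge x y a i j) (edge x′ y′ a′ i′ j′) (inj₁ (s , t , r)) (inj₁ (s′ , t′ , r′)) eq
          with refl , refl , refl ← parallel {i = i} {j} {i′ = i′} {j′} (trans s (sym s′)) (trans t (sym t′))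
          with refl ← eq
          with refl ← (let g = proj₁ (label (H.from ((x , y) , a))) in
               Fin.combine-injectiveʳ g i g i′ (Fin.toℕ-injective (trans (cong proj₁ r) (sym (cong proj₁ r′))))) = refl
        free-injective (edge x y a i j) (edge x′ y′ a′ i′ j′) (inj₂ (s , t , r)) (inj₂ (s′ , t′ , r′)) eq
          with refl , refl , refl ← parallel {i = i} {j} {i′ = i′} {j′} (trans s (sym s′)) (trans t (sym t′))
          with refl ← eq
          with refl ← (let g = proj₂ (label (H.from ((x , y) , a))) in
               Fin.combine-injectiveʳ g j g j′ (Fin.toℕ-injective (trans (cong proj₂ r) (sym (cong proj₂ r′))))) = refl
        -- Spare edges carry pairwise distinct labels, so the colour at either end determines the
        -- edge.
        free-injective (spareEdge i) (spareEdge i′) p p′ _ = cong inj₂ (Fin.toℕ-injective (trans (colour p) (sym (colour p′))))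
          where
          colour : ∀ {i u v c c′} → LabelledT (spareEdge i) u v c c′ → toℕ i ≡ c
          colour (inj₁ (_ , _ , r)) = cong proj₁ r
          colour (inj₂ (_ , _ , r)) = cong proj₂ r
        -- Opposite readings would put u on both sides of the bipartition.
        free-injective e e′ (inj₁ (s , _)) (inj₂ (_ , t′ , _)) _ = ⊥-elim (src≢tgt e e′ (trans s (sym t′)))
        free-injective e e′ (inj₂ (_ , t , _)) (inj₁ (s′ , _)) _ = ⊥-elim (src≢tgt e′ e (trans s′ (sym t)))
        free-injective (edge _ _ _ _ _) (spareEdge _) (inj₁ (s , _)) (inj₁ (s′ , _)) _ = ⊥-elim (point≢spare (trans s (sym s′)))
        free-injective (spareEdge _) (edge _ _ _ _ _) (inj₁ (s , _)) (inj₁ (s′ , _)) _ = ⊥-elim (point≢spare (trans s′ (sym s)))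
        free-injective (edge _ _ _ _ _) (spareEdge _) (inj₂ (s , _)) (inj₂ (s′ , _)) _ = ⊥-elim (point≢spare (trans s (sym s′)))
        free-injective (spareEdge _) (edge _ _ _ _ _) (inj₂ (s , _)) (inj₂ (s′ , _)) _ = ⊥-elim (point≢spare (trans s′ (sym s)))

        -- The value D is attained in any one bundle: fixing i fixes the colour at the point, while
        -- j still ranges over D edges.
        isConflictDegree : 1 ≤ δ → 1 ≤ q → IsConflictDegree G τ D
        isConflictDegree 1≤δ 1≤q = upper , (c₀ , V.from (src (e₀ i₀)) , V.from (tgt (e₀ i₀))) , ≤-antisym (upper _)
            (count-≥ _ (E.from ∘ e₀) (λ eq → e₀-injective (E-from-injective eq)) attained)
          where
          upper : ∀ ((c , u , v) : ℕ × Fin n × Fin n) → d G τ c u v ≤ D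
          upper (c , u , v) = count-≤ (labelled? G τ c u v) (λ e (c′ , p) → free (E.to e) (labelledT {e} {u} {v} {c} {c′} p))
            (λ {e} {e′} (c′ , p) (c″ , p′) eq → E-to-injective (free-injective (E.to e) (E.to e′)
              (labelledT {e} {u} {v} {c} {c′} p) (labelledT {e′} {u} {v} {c} {c″} p′) eq))
          i₀ = fromℕ< 1≤D
          h₀ : (Fin δ × Fin q) × Fin δ
          h₀ = (fromℕ< 1≤δ , fromℕ< 1≤q) , fromℕ< 1≤δ
          e₀ : Fin D → Edge
          e₀ j = inj₁ (h₀ , (i₀ , j))
          e₀-injective : ∀ {i j} → e₀ i ≡ e₀ j → i ≡ j
          e₀-injective refl = refl
          c₀ = proj₁ (labelT (e₀ i₀))
          attained : ∀ j → ∃ λ c′ → Labelled G τ (E.from (e₀ j)) (V.from (src (e₀ i₀))) (V.from (tgt (e₀ i₀))) c₀ c′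
          attained j = _ , inj₁ (cong (V.from ∘ src) eq , cong (V.from ∘ tgt) eq , cong labelT eq)
            where eq = E.strictlyInverseˡ (e₀ j)

        -- Reducing σ to groups gives an m-colouring γ, which some label forbids. The D² edges of
        -- that bundle run through all pairs of colours from the two forbidden groups, and one of
        -- them carries exactly the colours of σ.
        notColourable : (∀ (γ : Fin n → Fin m) → ∃ λ h → label h ≡ (γ (pointEnd h) , γ (lineEnd h))) →
          ¬ ProperConflictColouring G L τ
        notColourable unavoidable (σ , σ∈L , proper) =
          proper (E.from e) (V.from (src e)) (V.from (tgt e))
            (inj₁ (cong (V.from ∘ src) inv , cong (V.from ∘ tgt) inv , trans (cong labelT inv) labels))
          where
          c : ∀ v → Fin (m * D)
          c v = fromℕ< (∈-upTo⁻ (σ∈L v))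
          γ : Fin n → Fin m
          γ v = proj₁ (remQuot {m} D (c v))
          h = proj₁ (unavoidable γ)
          u = pointEnd h
          v = lineEnd h
          e : Edge
          e = inj₁ (H.to h , proj₂ (remQuot {m} D (c u)) , proj₂ (remQuot {m} D (c v)))
          inv = E.strictlyInverseˡ e
          recombine : ∀ v → toℕ (combine (γ v) (proj₂ (remQuot {m} D (c v)))) ≡ σ v
          recombine v = trans (cong toℕ (Fin.combine-remQuot {m} D (c v))) (Fin.toℕ-fromℕ< (∈-upTo⁻ (σ∈L v)))
          label≡ : label (H.from (H.to h)) ≡ (γ u , γ v)
          label≡ = trans (cong label (H.strictlyInverseʳ h)) (proj₂ (unavoidable γ))
          labels : labelT e ≡ (σ u , σ v)
          labels = cong₂ _,_ (trans (cong (λ l → toℕ (combine (proj₁ l) (proj₂ (remQuot {m} D (c u))))) label≡) (recombine u))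
                             (trans (cong (λ l → toℕ (combine (proj₂ l) (proj₂ (remQuot {m} D (c v))))) label≡) (recombine v))

    uncolourable : 2 ≤ m → 1 ≤ D → 1 ≤ δ → 1 ≤ q → δ * (D * D) ≤ Δ → m ^ n * (m * m ∸ 1) ^ ε < (m * m) ^ ε →
      Σ Multigraph λ G → Σ (Lists G) λ L → Σ (EdgeLabelling G) λ τ →
        IsMaxDegree G Δ × ¬ Cycle G 3 × ¬ Cycle G 4 × AllOfSize G (m * D) L × IsConflictDegree G τ D × ¬ ProperConflictColouring G L τ
    uncolourable 2≤m 1≤D 1≤δ 1≤q δD²≤Δ few =
      G , L , τ , isMaxDegree δD²≤Δ , noTriangle , no4Cycle , allOfSize , isConflictDegree 1≤D 1≤δ 1≤q , notColourable 1≤D (proj₂ labels)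
      where
      labels = unavoidableLabels 2≤m pointEnd lineEnd few
      open Labelled (proj₁ labels)

  uncolourableMultigraph : ∀ m D δ Δ → 2 ≤ m → 1 ≤ D → 1 ≤ δ → δ * (D * D) ≤ Δ → m * m * (m * m ∸ 1) ^ δ < (m * m) ^ δ →
    Σ Multigraph λ G → Σ (Lists G) λ L → Σ (EdgeLabelling G) λ τ →
      IsMaxDegree G Δ × ¬ Cycle G 3 × ¬ Cycle G 4 × AllOfSize G (m * D) L × IsConflictDegree G τ D × ¬ ProperConflictColouring G L τ
  uncolourableMultigraph m D δ Δ 2≤m 1≤D 1≤δ δD²≤Δ decay =
    let (q , 1≤q , few) = manyVertices {m} {δ} 2≤m decay
    in Construction.uncolourable m D δ q Δ 2≤m 1≤D 1≤δ 1≤q δD²≤Δ few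

fact1p4 : (em : ExcludedMiddle 0ℓ) (R : CompleteOrderedField) →
  let open Analysis em R in
  (∀ α → 1# ≤ α →
    Σ Multigraph λ G → Σ (Lists G) λ L → Σ (EdgeLabelling G) λ τ →
    ∃ λ (Δ : ℕ) → ∃ λ (ℓ : ℕ) → ∃ λ (D : ℕ) →
      IsMaxDegree G Δ
      × 2 ℕ.≤ Δ
      × ¬ Cycle G 3
      × ¬ Cycle G 4
      × AllOfSize G ℓ L
      × + ℓ ≡ ⌈ α * √ (fromℕ Δ / ln (fromℕ Δ)) ⌉
      × IsConflictDegree G τ D
      × fromℕ D ≈ fromℕ ℓ ^ʳ f α
      × ¬ ProperConflictColouring G L τ)
  × (∀ α → 1# ≤ α → 0# ≤ f α)
  × (∀ α β → 1# ≤ α → α ≤ β → f α ≤ f β)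
  × (∀ ε → 0# < ε → ∃ λ A → ∀ α → 1# ≤ α → A ≤ α → ∣ f α - 1# ∣ ≤ ε)
  × (∀ (o : ℕ → ℝ) → (∀ n → 0# ≤ o n) → o ⟶ 0# →
      ∃ λ N → ∀ n → N ℕ.≤ n → f (fromℕ 2 * √ (fromℕ 2) + o n) ≈ fromℕ 15 / fromℕ 16)
fact1p4 em R = (λ α 1≤α → fromParameters (suitableParameters 1≤α)) , f-nonNeg , f-mono , f-limit , f-15/16
  where
  open Analysis em R
  open ParameterChoice em R
  fromParameters : ∀ {α} → Parameters α →
    Σ Multigraph λ G → Σ (Lists G) λ L → Σ (EdgeLabelling G) λ τ →
    ∃ λ (Δ : ℕ) → ∃ λ (ℓ : ℕ) → ∃ λ (D : ℕ) →
    IsMaxDegree G Δ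
    × 2 ℕ.≤ Δ
    × ¬ Cycle G 3
    × ¬ Cycle G 4
    × AllOfSize G ℓ L
    × + ℓ ≡ ⌈ α * √ (fromℕ Δ / ln (fromℕ Δ)) ⌉
    × IsConflictDegree G τ D
    × fromℕ D ≈ fromℕ ℓ ^ʳ f α
    × ¬ ProperConflictColouring G L τ
  fromParameters p =
    let open Parameters p
        1≤D = ℕ.m^n>0 m {{ℕ.>-nonZero (ℕ.≤-trans (ℕ.s≤s ℕ.z≤n) 2≤m)}} k
        (G , L , τ , maxDegree , no3 , no4 , size , conflictDegree , notColourable) =
          BlownUpPlane.uncolourableMultigraph m (m ℕ.^ k) δ Δ 2≤m 1≤D 1≤δ δD²≤Δ decay
    in G , L , τ , Δ , m ℕ.^ suc k , m ℕ.^ k , maxDegree , 2≤Δ , no3 , no4 , size , ℓ≡ , conflictDegree , D≈ , notColourable
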